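{- There exists an absolute constant $C>0$ such that the following holds. Let $0<\varepsilon<1/2$ and let $t,n$ be positive integers with $n>\varepsilon^{ -Ct}$. Then every red/blue colouring of the edges of $K_n$ in which every vertex is incident to at least $\varepsilon n$ red edges and at least $\varepsilon n$ blue edges contains a $t$-locally-unavoidable pattern, i.e. there is a set $W$ of vertices such that the colouring restricted to the complete graph on $W$ satisfies one of the following: (i) $|W|=2t$ and for some colour $c$, $W=P\cup Q$ with $P,Q$ disjoint, $|P|=|Q|=t$, all edges between $P$ and $Q$ of colour $c$ and all edges inside $P$ and inside $Q$ of the other colour (so colour $c$ induces exactly a $K_{t,t}$); or (ii) $|W|=4t$ and the restricted colouring lies in $\mathcal{P}_t$ (with the colours possibly interchanged is not required; exactly as defined below).
   Context: For a positive integer $m$, a 2-colouring of $K_{4m}$ is in $\mathcal{P}_m$ if its vertex set can be partitioned into four sets $V_1,V_2,V_3,V_4$, each of size $m$, such that: all edges with both endpoints in $V_1\cup V_2$ are red; all edges with both endpoints in $V_3\cup V_4$ are blue; all edges between $V_1$ and $V_3$ are red; all edges between $V_2$ and $V_4$ are red; and all remaining edges (those between $V_1$ and $V_4$ and those between $V_2$ and $V_3$) are blue. -}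

module Defs where

open import Data.Nat using (ℕ; zero; suc; _+_; _*_; _^_; _≤_; _<_)
open import Data.Bool using (Bool; true; false; not; _∧_)
open import Data.Fin using (Fin; zero; suc; _≟_)
open import Data.List using (List; []; _∷_)
import Data.List
open import Data.List.Base using (allFin)
open import Data.Product using (Σ; _×_; _,_)
open import Data.Sum using (_⊎_)
open import Relation.Nullary using (¬_; does)
open import Relation.Binary.PropositionalEquality using (_≡_)

-- A red/blue colouring of the edges of K_n: a symmetric function on pairs of
-- vertices; true = red, false = blue. Diagonal values are irrelevant.
Colouring : ℕ → Set
Colouring n = Fin n → Fin n → Bool

red blue : Bool
red = true
blue = false

Symmetric : ∀ {n} → Colouring n → Set
Symmetric {n} c = (u v : Fin n) → c u v ≡ c v u

countTrue : List Bool → ℕ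
countTrue [] = 0
countTrue (true ∷ bs) = suc (countTrue bs)
countTrue (false ∷ bs) = countTrue bs

degIn : ∀ {n} → Colouring n → Bool → Fin n → ℕ
degIn {n} c col u =
  countTrue (Data.List.map (λ v → not (does (u ≟ v)) ∧ does (Data.Bool._≟_ (c u v) col)) (allFin n))
  where import Data.Bool

-- a vertex-disjoint family of k blocks of t vertices each
-- (emb a i is the i-th vertex of block a), injective overall
Injective2 : ∀ {k t n} → (Fin k → Fin t → Fin n) → Set
Injective2 {k} {t} emb = ∀ a b i j → emb a i ≡ emb b j → (a ≡ b) × (i ≡ j)

FollowsPattern : ∀ {k t n} → Colouring n → (Fin k → Fin t → Fin n) →
                 (Fin k → Fin k → Bool) → Set
FollowsPattern {k} {t} c emb pat =
  ∀ a b i j → ¬ ((a ≡ b) × (i ≡ j)) → c (emb a i) (emb b j) ≡ pat a b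

patKtt : Bool → Fin 2 → Fin 2 → Bool
patKtt col zero zero = not col
patKtt col (suc zero) (suc zero) = not col
patKtt col zero (suc zero) = col
patKtt col (suc zero) zero = col

-- Pattern P_t: blocks V1..V4 are 0..3
patP : Fin 4 → Fin 4 → Bool
patP zero zero = red
patP (suc zero) (suc zero) = red
patP zero (suc zero) = red
patP (suc zero) zero = red
patP (suc (suc zero)) (suc (suc zero)) = blue
patP (suc (suc (suc zero))) (suc (suc (suc zero))) = blue
patP (suc (suc zero)) (suc (suc (suc zero))) = blue
patP (suc (suc (suc zero))) (suc (suc zero)) = blue
patP zero (suc (suc zero)) = red
patP (suc (suc zero)) zero = red
patP (suc zero) (suc (suc (suc zero))) = red
patP (suc (suc (suc zero))) (suc zero) = red
patP zero (suc (suc (suc zero))) = blue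
patP (suc (suc (suc zero))) zero = blue
patP (suc zero) (suc (suc zero)) = blue
patP (suc (suc zero)) (suc zero) = blue

HasKtt : ∀ {n} → ℕ → Colouring n → Set
HasKtt {n} t c = Σ Bool λ col → Σ (Fin 2 → Fin t → Fin n) λ emb →
  Injective2 emb × FollowsPattern c emb (patKtt col)

HasP : ∀ {n} → ℕ → Colouring n → Set
HasP {n} t c = Σ (Fin 4 → Fin t → Fin n) λ emb →
  Injective2 emb × FollowsPattern c emb patP

LocallyUnavoidable : ∀ {n} → ℕ → Colouring n → Set
LocallyUnavoidable t c = HasKtt t c ⊎ HasP t c

{-# OPTIONS --safe #-}
module Submission where

open import Defs
open import Data.Nat using (ℕ; _+_; _*_; _^_; _≤_; _<_)
open import Data.Bool using (Bool)
open import Data.Product using (Σ; _×_)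
open import Data.Nat using (zero; suc; _≤ᵇ_; _≤?_; z≤n; s≤s; s≤s⁻¹; NonZero; >-nonZero)
open import Data.Nat.Properties hiding (_≟_)
open import Data.Nat.Tactic.RingSolver using (solve-∀)
open import Data.Bool using (true; false; not; _∧_; _∨_; T)
import Data.Bool
open import Data.Bool.Properties using (∧-assoc; ∧-comm; ∧-identityʳ)
open import Data.Empty using (⊥-elim)
open import Data.Fin using (Fin; zero; suc; _≟_; toℕ; _↑ˡ_; _↑ʳ_)
open import Data.Fin.Properties using (toℕ-↑ˡ; toℕ-↑ʳ; toℕ<n; toℕ-injective)
open import Data.List using (List; []; _∷_; _++_; map; length; allFin; cartesianProduct)
open import Data.List.Properties using (map-tabulate; length-tabulate)
open import Data.List.Relation.Unary.All using (All; []; _∷_)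
import Data.List.Relation.Unary.All as All
open import Data.List.Relation.Unary.AllPairs using (AllPairs; []; _∷_)
open import Data.Product using (∃; _,_; proj₁; proj₂)
open import Data.Sum using (_⊎_; inj₁; inj₂)
open import Data.Unit using (tt)
open import Data.Vec using (Vec; []; _∷_; head; tail)
open import Function using (_∘_; id; case_of_)
open import Relation.Binary.Definitions using (tri<; tri≈; tri>)
open import Relation.Binary.PropositionalEquality using (_≡_; refl; sym; trans; cong; cong₂; subst; subst₂)
open import Relation.Nullary using (¬_; does; yes; no)

-- Call (u₁ , u₂) and (w₁ , w₂) alternating if u₁ w₁ u₂ w₂ is a 4-cycle coloured blue, red, blue, red.
-- Starting from vertices u₁ of large red degree one finds a proportion (p/q)^O(1) of all pairs of
-- pairs alternating. Viewing this as a dense bipartite graph between two copies of the set of pairs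
-- of vertices, a Ramsey argument that keeps track of common neighbourhoods gives homogeneous
-- sequences of pairs on both sides that are completely joined. Their coordinates are monochromatic
-- cliques T₁, T₂, S₁, S₂ with homogeneous edges in between, and the pattern is read off their colours.

-- Finite sums and cardinalities

-- The exponent linear in `t` is the obstacle. Ramsey's theorem inside both sides of a complete
-- bipartite graph needs sides exponential in `t`, and the usual counting finds such a graph only
-- for doubly exponential `n`. So the sequence on one side is grown together with its common
-- neighbourhood: `32 * t` steps cost only an exponential factor, and what is left of the
-- neighbourhood still suffices for an ordinary Ramsey argument on the other side. A colour class
-- may be large and yet have few common neighbours; hence the classes are chosen to retain a high
-- moment of the degrees, not cardinality. Pairs are used because a single bipartite graph then
-- encodes all four joins of the cycle. The price is that two pairs may share a coordinate. This is
-- recorded as one more bit of colour; it is excluded because a pair shares a coordinate with at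
-- most `2n` of the `n²` pairs, while more than `2n` candidates survive to the end. That safety
-- margin costs a factor `n` out of `n²`, and the remaining factor `n` pays for all exponential
-- losses.

∑ : {X : Set} → List X → (X → ℕ) → ℕ
∑ []       f = 0
∑ (x ∷ xs) f = f x + ∑ xs f

ι : Bool → ℕ
ι true  = 1
ι false = 0

# : {X : Set} → List X → (X → Bool) → ℕ
# xs P = ∑ xs (λ x → ι (P x))

∑-cong : {X : Set} (xs : List X) {f g : X → ℕ} → (∀ x → f x ≡ g x) → ∑ xs f ≡ ∑ xs g
∑-cong []       h = refl
∑-cong (x ∷ xs) h = cong₂ _+_ (h x) (∑-cong xs h)

∑-mono : {X : Set} (xs : List X) {f g : X → ℕ} → (∀ x → f x ≤ g x) → ∑ xs f ≤ ∑ xs g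
∑-mono []       h = z≤n
∑-mono (x ∷ xs) h = +-mono-≤ (h x) (∑-mono xs h)

∑-+ : {X : Set} (xs : List X) (f g : X → ℕ) → ∑ xs (λ x → f x + g x) ≡ ∑ xs f + ∑ xs g
∑-+ []       f g = refl
∑-+ (x ∷ xs) f g rewrite ∑-+ xs f g = interchange (f x) (g x) (∑ xs f) (∑ xs g)
  where
  interchange : ∀ a b c d → (a + b) + (c + d) ≡ (a + c) + (b + d)
  interchange = solve-∀

∑-*ˡ : {X : Set} (xs : List X) (c : ℕ) (f : X → ℕ) → ∑ xs (λ x → c * f x) ≡ c * ∑ xs f
∑-*ˡ []       c f = sym (*-zeroʳ c)
∑-*ˡ (x ∷ xs) c f rewrite ∑-*ˡ xs c f = sym (*-distribˡ-+ c (f x) (∑ xs f))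

∑-*ʳ : {X : Set} (xs : List X) (c : ℕ) (f : X → ℕ) → ∑ xs (λ x → f x * c) ≡ ∑ xs f * c
∑-*ʳ []       c f = refl
∑-*ʳ (x ∷ xs) c f rewrite ∑-*ʳ xs c f = sym (*-distribʳ-+ c (f x) (∑ xs f))

∑-const : {X : Set} (xs : List X) (c : ℕ) → ∑ xs (λ _ → c) ≡ length xs * c
∑-const []       c = refl
∑-const (x ∷ xs) c = cong (c +_) (∑-const xs c)

∑-swap : {X Y : Set} (xs : List X) (ys : List Y) (f : X → Y → ℕ) →
         ∑ xs (λ x → ∑ ys (f x)) ≡ ∑ ys (λ y → ∑ xs (λ x → f x y))
∑-swap []       ys f = trans (sym (*-zeroʳ (length ys))) (sym (∑-const ys 0))
∑-swap (x ∷ xs) ys f rewrite ∑-swap xs ys f = sym (∑-+ ys (f x) (λ y → ∑ xs (λ x → f x y)))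

∑-++ : {X : Set} (xs ys : List X) (f : X → ℕ) → ∑ (xs ++ ys) f ≡ ∑ xs f + ∑ ys f
∑-++ []       ys f = refl
∑-++ (x ∷ xs) ys f rewrite ∑-++ xs ys f = sym (+-assoc (f x) (∑ xs f) (∑ ys f))

∑-map : {X Y : Set} (g : X → Y) (xs : List X) (f : Y → ℕ) → ∑ (map g xs) f ≡ ∑ xs (f ∘ g)
∑-map g []       f = refl
∑-map g (x ∷ xs) f = cong (f (g x) +_) (∑-map g xs f)

∑-cartesianProduct : {X Y : Set} (xs : List X) (ys : List Y) (f : X × Y → ℕ) →
                     ∑ (cartesianProduct xs ys) f ≡ ∑ xs (λ x → ∑ ys (λ y → f (x , y)))
∑-cartesianProduct []       ys f = refl
∑-cartesianProduct (x ∷ xs) ys f =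
  trans (∑-++ (map (x ,_) ys) (cartesianProduct xs ys) f)
        (cong₂ _+_ (∑-map (x ,_) ys f) (∑-cartesianProduct xs ys f))

∑-<⇒∃< : {X : Set} (xs : List X) {f g : X → ℕ} → ∑ xs g < ∑ xs f → ∃ λ x → g x < f x
∑-<⇒∃< (x ∷ xs) {f} {g} lt with f x ≤? g x
... | no  f≰g = x , ≰⇒> f≰g
... | yes f≤g = ∑-<⇒∃< xs (≰⇒> λ le → <⇒≱ lt (+-mono-≤ f≤g le))

#-mono : {X : Set} (xs : List X) {P Q : X → Bool} →
         (∀ x → P x ≡ true → Q x ≡ true) → # xs P ≤ # xs Q
#-mono xs {P} {Q} h = ∑-mono xs pointwise
  where
  pointwise : ∀ x → ι (P x) ≤ ι (Q x)
  pointwise x with P x | Q x | h x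
  ... | false | _     | _ = z≤n
  ... | true  | true  | _ = ≤-refl
  ... | true  | false | k with k refl
  ...   | ()

#-≤length : {X : Set} (xs : List X) (P : X → Bool) → # xs P ≤ length xs
#-≤length []       P = z≤n
#-≤length (x ∷ xs) P with P x
... | true  = s≤s (#-≤length xs P)
... | false = m≤n⇒m≤1+n (#-≤length xs P)

ι-∧ : ∀ a b → ι (a ∧ b) ≡ ι a * ι b
ι-∧ true  b = sym (*-identityˡ (ι b))
ι-∧ false b = refl

ι-split : ∀ a b → ι a ≡ ι (a ∧ b) + ι (a ∧ not b)
ι-split true  true  = refl
ι-split true  false = refl
ι-split false _     = refl

#-split : {X : Set} (xs : List X) (P p : X → Bool) →
          # xs P ≡ # xs (λ x → P x ∧ p x) + # xs (λ x → P x ∧ not (p x))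
#-split xs P p = trans (∑-cong xs (λ x → ι-split (P x) (p x))) (∑-+ xs _ _)

∧-true : ∀ a b → a ∧ b ≡ true → a ≡ true × b ≡ true
∧-true true true refl = refl , refl

not-true : ∀ a → not a ≡ true → a ≡ false
not-true false refl = refl

-- Convexity of powers

^-distribˡ-* : ∀ a b m → (a * b) ^ m ≡ a ^ m * b ^ m
^-distribˡ-* a b zero    = refl
^-distribˡ-* a b (suc m) rewrite ^-distribˡ-* a b m = interchange a b (a ^ m) (b ^ m)
  where
  interchange : ∀ a b c d → (a * b) * (c * d) ≡ (a * c) * (b * d)
  interchange = solve-∀

rearrangement-sorted : ∀ {u w s r} → u ≤ w → s ≤ r → u * r + w * s ≤ u * s + w * r
rearrangement-sorted {u} {w} {s} {r} u≤w s≤r with m≤n⇒∃[o]m+o≡n u≤w | m≤n⇒∃[o]m+o≡n s≤r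
... | d , refl | e , refl = ≤-trans (m≤m+n _ (d * e)) (≤-reflexive (eq u d s e))
  where
  eq : ∀ u d s e → u * (s + e) + (u + d) * s + d * e ≡ u * s + (u + d) * (s + e)
  eq = solve-∀

power-rearrangement : ∀ m u w → u * w ^ m + w * u ^ m ≤ u * u ^ m + w * w ^ m
power-rearrangement m u w with ≤-total u w
... | inj₁ u≤w = rearrangement-sorted u≤w (^-monoˡ-≤ m u≤w)
... | inj₂ w≤u =
  ≤-trans (≤-reflexive (+-comm (u * w ^ m) _))
  (≤-trans (rearrangement-sorted w≤u (^-monoˡ-≤ m w≤u)) (≤-reflexive (+-comm (w * w ^ m) _)))

weighted-chebyshev : ∀ m a b u w →
  (a * u + b * w) * (a * u ^ m + b * w ^ m) ≤ (a + b) * (a * u ^ suc m + b * w ^ suc m)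
weighted-chebyshev m a b u w = begin
  (a * u + b * w) * (a * u ^ m + b * w ^ m)
    ≡⟨ expand a b u w (u ^ m) (w ^ m) ⟩
  a * a * (u * u ^ m) + b * b * (w * w ^ m) + a * b * (u * w ^ m + w * u ^ m)
    ≤⟨ +-monoʳ-≤ _ (*-monoʳ-≤ (a * b) (power-rearrangement m u w)) ⟩
  a * a * (u * u ^ m) + b * b * (w * w ^ m) + a * b * (u * u ^ m + w * w ^ m)
    ≡⟨ collect a b u w (u ^ m) (w ^ m) ⟩
  (a + b) * (a * (u * u ^ m) + b * (w * w ^ m)) ∎
  where
  open ≤-Reasoning
  expand : ∀ a b u w s r → (a * u + b * w) * (a * s + b * r) ≡
           a * a * (u * s) + b * b * (w * r) + a * b * (u * r + w * s)
  expand = solve-∀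
  collect : ∀ a b u w s r → a * a * (u * s) + b * b * (w * r) + a * b * (u * s + w * r) ≡
            (a + b) * (a * (u * s) + b * (w * r))
  collect = solve-∀

-- Each induction step trades one factor `a * u + b * w` for one factor `a + b` by Chebyshev's
-- inequality.
weighted-power-mean : ∀ m a b u w →
  (a * u + b * w) ^ m * (a + b) ≤ (a + b) ^ m * (a * u ^ m + b * w ^ m)
weighted-power-mean zero    a b u w =
  ≤-reflexive (cong (1 *_) (cong₂ _+_ (sym (*-identityʳ a)) (sym (*-identityʳ b))))
weighted-power-mean (suc m) a b u w = begin
  (x * x ^ m) * (a + b)                               ≡⟨ *-assoc x (x ^ m) (a + b) ⟩
  x * (x ^ m * (a + b))                               ≤⟨ *-monoʳ-≤ x (weighted-power-mean m a b u w) ⟩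
  x * ((a + b) ^ m * (a * u ^ m + b * w ^ m))         ≡⟨ swap x ((a + b) ^ m) _ ⟩
  (a + b) ^ m * (x * (a * u ^ m + b * w ^ m))
    ≤⟨ *-monoʳ-≤ ((a + b) ^ m) (weighted-chebyshev m a b u w) ⟩
  (a + b) ^ m * ((a + b) * (a * u ^ suc m + b * w ^ suc m)) ≡⟨ shift (a + b) ((a + b) ^ m) _ ⟩
  (a + b) * (a + b) ^ m * (a * u ^ suc m + b * w ^ suc m) ∎
  where
  open ≤-Reasoning
  x : ℕ
  x = a * u + b * w
  swap : ∀ x y z → x * (y * z) ≡ y * (x * z)
  swap = solve-∀
  shift : ∀ s p z → p * (s * z) ≡ s * p * z
  shift = solve-∀

-- Radon's inequality (x+z)^m/(a+b)^(m-1) ≤ x^m/a^(m-1) + z^m/b^(m-1), without denominators.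
radon : ∀ m a b x z →
  (x + z) ^ m * (a ^ m * b ^ m) * (a + b) ≤ (a + b) ^ m * (x ^ m * b ^ m * a + z ^ m * a ^ m * b)
radon m a b x z = begin
  (x + z) ^ m * (a ^ m * b ^ m) * (a + b)
    ≡⟨ cong (λ h → (x + z) ^ m * h * (a + b)) (sym (^-distribˡ-* a b m)) ⟩
  (x + z) ^ m * (a * b) ^ m * (a + b)
    ≡⟨ cong (_* (a + b)) (sym (^-distribˡ-* (x + z) (a * b) m)) ⟩
  ((x + z) * (a * b)) ^ m * (a + b)
    ≡⟨ cong (λ h → h ^ m * (a + b)) (common a b x z) ⟩
  -- The points being averaged are `x / a` and `z / b` with weights `a` and `b`, scaled by `a * b`
  -- to clear denominators.
  (a * (x * b) + b * (z * a)) ^ m * (a + b)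
    ≤⟨ weighted-power-mean m a b (x * b) (z * a) ⟩
  (a + b) ^ m * (a * (x * b) ^ m + b * (z * a) ^ m)
    ≡⟨ cong ((a + b) ^ m *_) (cong₂ _+_ (pull a x b) (pull b z a)) ⟩
  (a + b) ^ m * (x ^ m * b ^ m * a + z ^ m * a ^ m * b) ∎
  where
  open ≤-Reasoning
  common : ∀ a b x z → (x + z) * (a * b) ≡ a * (x * b) + b * (z * a)
  common = solve-∀
  pull : ∀ a x b → a * (x * b) ^ m ≡ x ^ m * b ^ m * a
  pull a x b = trans (*-comm a _) (cong (_* a) (^-distribˡ-* x b m))

-- Induction by `radon` with weight 1 for the head and the length of the tail for the rest. That
-- length must be nonzero for its power to be cancelled, hence the separate singleton case.
jensen : {X : Set} (xs : List X) (f : X → ℕ) (m : ℕ) →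
         ∑ xs f ^ m * length xs ≤ length xs ^ m * ∑ xs (λ x → f x ^ m)
jensen []                 f m = ≤-trans (≤-reflexive (*-zeroʳ (0 ^ m))) z≤n
jensen (x ∷ [])           f m =
  ≤-reflexive (trans (*-identityʳ _) (trans (cong (_^ m) (+-identityʳ (f x)))
    (sym (trans (cong₂ _*_ (^-zeroˡ m) (+-identityʳ (f x ^ m))) (*-identityˡ _)))))
jensen (x ∷ xs@(_ ∷ _)) f m = *-cancelʳ-≤ _ _ (b ^ m) ⦃ m^n≢0 b m ⦄ (begin
  (f x + s) ^ m * (1 + b) * b ^ m               ≡⟨ arrange ((f x + s) ^ m) (1 + b) (b ^ m) ⟩
  (f x + s) ^ m * (1 * b ^ m) * (1 + b)
    ≡⟨ cong (λ h → (f x + s) ^ m * (h * b ^ m) * (1 + b)) (sym (^-zeroˡ m)) ⟩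
  (f x + s) ^ m * (1 ^ m * b ^ m) * (1 + b)     ≤⟨ radon m 1 b (f x) s ⟩
  (1 + b) ^ m * (f x ^ m * b ^ m * 1 + s ^ m * 1 ^ m * b)
    ≡⟨ cong (λ h → (1 + b) ^ m * (f x ^ m * b ^ m * 1 + h)) (trans (cong (λ h → s ^ m * h * b) (^-zeroˡ m)) (cong (_* b) (*-identityʳ (s ^ m)))) ⟩
  (1 + b) ^ m * (f x ^ m * b ^ m * 1 + s ^ m * b)
    ≤⟨ *-monoʳ-≤ ((1 + b) ^ m) (+-monoʳ-≤ _ (jensen xs f m)) ⟩
  (1 + b) ^ m * (f x ^ m * b ^ m * 1 + b ^ m * ∑ xs (λ x → f x ^ m))
    ≡⟨ collect ((1 + b) ^ m) (f x ^ m) (b ^ m) _ ⟩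
  (1 + b) ^ m * (f x ^ m + ∑ xs (λ x → f x ^ m)) * b ^ m ∎)
  where
  open ≤-Reasoning
  b s : ℕ
  b = length xs
  s = ∑ xs f
  arrange : ∀ x y z → x * y * z ≡ x * (1 * z) * y
  arrange = solve-∀
  collect : ∀ t x b s → t * (x * b * 1 + b * s) ≡ t * (x + s) * b
  collect = solve-∀

-- Subadditivity of normalised moments: `x y` and `z y` are the degrees of `y` into two disjoint
-- sets of sizes `a` and `b`, and `radon` is applied at every `y`. When one set is empty the
-- denominators degenerate, but then the bounds make its degrees vanish.
combine-moments : {Y : Set} (ys : List Y) (q x z : Y → ℕ) (m a b W : ℕ) →
  (∀ y → x y ≤ a) → (∀ y → z y ≤ b) →
  ∑ ys (λ y → q y * x y ^ m) * a ≤ a ^ m * W →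
  ∑ ys (λ y → q y * z y ^ m) * b ≤ b ^ m * W →
  ∑ ys (λ y → q y * (x y + z y) ^ m) * (a + b) ≤ (a + b) ^ m * (W + W)
combine-moments ys q x z m zero b W x≤ z≤ h₁ h₂ = begin
  ∑ ys (λ y → q y * (x y + z y) ^ m) * b
    ≡⟨ cong (_* b) (∑-cong ys λ y → cong (λ h → q y * (h + z y) ^ m) (n≤0⇒n≡0 (x≤ y))) ⟩
  ∑ ys (λ y → q y * z y ^ m) * b          ≤⟨ h₂ ⟩
  b ^ m * W                               ≤⟨ *-monoʳ-≤ (b ^ m) (m≤m+n W W) ⟩
  b ^ m * (W + W)                         ∎
  where open ≤-Reasoning
combine-moments ys q x z m a@(suc _) zero W x≤ z≤ h₁ h₂ = begin
  ∑ ys (λ y → q y * (x y + z y) ^ m) * (a + 0)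
    ≡⟨ cong₂ _*_ (∑-cong ys λ y → cong (λ h → q y * h ^ m) (trans (cong (x y +_) (n≤0⇒n≡0 (z≤ y))) (+-identityʳ (x y)))) (+-identityʳ a) ⟩
  ∑ ys (λ y → q y * x y ^ m) * a          ≤⟨ h₁ ⟩
  a ^ m * W                               ≤⟨ *-monoʳ-≤ (a ^ m) (m≤m+n W W) ⟩
  a ^ m * (W + W)                         ≡⟨ cong (λ h → h ^ m * (W + W)) (sym (+-identityʳ a)) ⟩
  (a + 0) ^ m * (W + W)                   ∎
  where open ≤-Reasoning
combine-moments ys q x z m a@(suc _) b@(suc _) W x≤ z≤ h₁ h₂ =
  *-cancelʳ-≤ _ _ (a ^ m * b ^ m) ⦃ m*n≢0 (a ^ m) (b ^ m) ⦃ m^n≢0 a m ⦄ ⦃ m^n≢0 b m ⦄ ⦄ (begin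
  ∑ ys (λ y → q y * (x y + z y) ^ m) * s * (α * β)
    ≡⟨ trans (*-assoc (∑ ys (λ y → q y * (x y + z y) ^ m)) s (α * β)) (sym (∑-*ʳ ys (s * (α * β)) (λ y → q y * (x y + z y) ^ m))) ⟩
  ∑ ys (λ y → q y * (x y + z y) ^ m * (s * (α * β)))
    ≤⟨ ∑-mono ys (λ y → ≤-trans (≤-reflexive (to-radon (q y) _ s (α * β)))
         (≤-trans (*-monoʳ-≤ (q y) (radon m a b (x y) (z y)))
                  (≤-reflexive (from-radon (q y) (s ^ m) (x y ^ m) (z y ^ m) α β a b)))) ⟩
  ∑ ys (λ y → s ^ m * (q y * x y ^ m * (β * a) + q y * z y ^ m * (α * b)))
    ≡⟨ ∑-*ˡ ys (s ^ m) _ ⟩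
  s ^ m * ∑ ys (λ y → q y * x y ^ m * (β * a) + q y * z y ^ m * (α * b))
    ≡⟨ cong (s ^ m *_) (trans (∑-+ ys _ _) (cong₂ _+_ (∑-*ʳ ys (β * a) _) (∑-*ʳ ys (α * b) _))) ⟩
  s ^ m * (F₁ * (β * a) + F₂ * (α * b))
    ≡⟨ regroup (s ^ m) F₁ F₂ α β a b ⟩
  s ^ m * (β * (F₁ * a) + α * (F₂ * b))
    ≤⟨ *-monoʳ-≤ (s ^ m) (+-mono-≤ (*-monoʳ-≤ β h₁) (*-monoʳ-≤ α h₂)) ⟩
  s ^ m * (β * (α * W) + α * (β * W))
    ≡⟨ collect (s ^ m) α β W ⟩
  s ^ m * (W + W) * (α * β) ∎)
  where
  open ≤-Reasoning
  s α β F₁ F₂ : ℕ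
  s = a + b
  α = a ^ m
  β = b ^ m
  F₁ = ∑ ys (λ y → q y * x y ^ m)
  F₂ = ∑ ys (λ y → q y * z y ^ m)
  to-radon : ∀ q p s r → q * p * (s * r) ≡ q * (p * r * s)
  to-radon = solve-∀
  from-radon : ∀ q t x z α β a b → q * (t * (x * β * a + z * α * b)) ≡ t * (q * x * (β * a) + q * z * (α * b))
  from-radon = solve-∀
  regroup : ∀ t F₁ F₂ α β a b → t * (F₁ * (β * a) + F₂ * (α * b)) ≡ t * (β * (F₁ * a) + α * (F₂ * b))
  regroup = solve-∀
  collect : ∀ t α β W → t * (β * (α * W) + α * (β * W)) ≡ t * (W + W) * (α * β)
  collect = solve-∀

-- Ramsey sequences with large common neighbourhoods

vec-η : {A : Set} {l : ℕ} (v : Vec A (suc l)) → v ≡ head v ∷ tail v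
vec-η (_ ∷ _) = refl

-- `Big W P` is any notion of "size at least about `W`" that survives halving; fixing the `l` bits
-- of the label one by one costs a factor 2 each. It serves both for moments (`Heavy`) and for plain
-- counting.
class-pigeonhole : {X : Set} (Big : ℕ → (X → Bool) → Set) →
  (∀ W P (p : X → Bool) → Big (W + W) P → Big W (λ x → P x ∧ p x) ⊎ Big W (λ x → P x ∧ not (p x))) →
  ∀ l (χ : X → Vec Bool l) W P → Big (2 ^ l * W) P →
  Σ (Vec Bool l) λ k → Σ (X → Bool) λ P′ →
    Big W P′ × (∀ x → P′ x ≡ true → P x ≡ true × χ x ≡ k)
class-pigeonhole Big halve zero χ W P big =
  [] , P , subst (λ V → Big V P) (*-identityˡ W) big , λ x Px → Px , nil (χ x)
  where
  nil : (v : Vec Bool 0) → v ≡ []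
  nil [] = refl
class-pigeonhole {X} Big halve (suc l) χ W P big
  with halve (2 ^ l * W) P (λ x → head (χ x)) (subst (λ V → Big V P) (double (2 ^ l) W) big)
  where
  double : ∀ w W → 2 * w * W ≡ w * W + w * W
  double = solve-∀
... | inj₁ big₁ with class-pigeonhole Big halve l (tail ∘ χ) W _ big₁
...   | k , P′ , big′ , h = true ∷ k , P′ , big′ , λ x P′x →
        let Px , bit = ∧-true (P x) _ (proj₁ (h x P′x)) in
        Px , trans (vec-η (χ x)) (cong₂ _∷_ bit (proj₂ (h x P′x)))
class-pigeonhole {X} Big halve (suc l) χ W P big
    | inj₂ big₂ with class-pigeonhole Big halve l (tail ∘ χ) W _ big₂
...   | k , P′ , big′ , h = false ∷ k , P′ , big′ , λ x P′x →
        let Px , bit = ∧-true (P x) _ (proj₁ (h x P′x)) in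
        Px , trans (vec-η (χ x)) (cong₂ _∷_ (not-true _ bit) (proj₂ (h x P′x)))

-- Counts the `m`-tuples in `P`, repetitions allowed, together with a common neighbour in `Q`.
moment : {X Y : Set} → List X → List Y → (X → Y → Bool) → ℕ → (X → Bool) → (Y → Bool) → ℕ
moment xs ys E m P Q = ∑ ys (λ y → ι (Q y) * # xs (λ x → P x ∧ E x y) ^ m)

-- Fix the first entry `v` of the tuple: the common neighbour must then lie in the neighbourhood of
-- `v`.
moment-suc : {X Y : Set} (xs : List X) (ys : List Y) (E : X → Y → Bool) (m : ℕ)
  (P : X → Bool) (Q : Y → Bool) →
  moment xs ys E (suc m) P Q ≡ ∑ xs (λ v → ι (P v) * moment xs ys E m P (λ y → Q y ∧ E v y))
moment-suc xs ys E m P Q = trans (∑-cong ys per-y) (trans (sym (∑-swap xs ys _)) (∑-cong xs λ v → ∑-*ˡ ys (ι (P v)) _))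
  where
  move : ∀ p e q D → q * (p * e * D) ≡ p * (q * e * D)
  move = solve-∀
  per-y : ∀ y → ι (Q y) * # xs (λ x → P x ∧ E x y) ^ suc m ≡
                ∑ xs (λ v → ι (P v) * (ι (Q y ∧ E v y) * # xs (λ x → P x ∧ E x y) ^ m))
  per-y y = trans (cong (ι (Q y) *_) (sym (∑-*ʳ xs D _))) (trans (sym (∑-*ˡ xs (ι (Q y)) _))
    (∑-cong xs λ v → trans (cong (λ h → ι (Q y) * (h * D)) (ι-∧ (P v) (E v y)))
      (trans (move (ι (P v)) (ι (E v y)) (ι (Q y)) D)
        (cong (λ h → ι (P v) * (h * D)) (sym (ι-∧ (Q y) (E v y)))))))
    where
    D : ℕ
    D = # xs (λ x → P x ∧ E x y) ^ m

-- The normalised moment |P| * moment m / |P|^m exceeds W.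
Heavy : {X Y : Set} → List X → List Y → (X → Y → Bool) → ℕ → (Y → Bool) → ℕ → (X → Bool) → Set
Heavy xs ys E m Q W P = # xs P ^ m * W < moment xs ys E m P Q * # xs P

-- Degrees into `P` are sums of degrees into the two parts, so if neither part were heavy,
-- `combine-moments` would contradict the heaviness of `P`.
heavy-halve : {X Y : Set} (xs : List X) (ys : List Y) (E : X → Y → Bool) (m : ℕ) (Q : Y → Bool) →
  ∀ W P p → Heavy xs ys E m Q (W + W) P →
  Heavy xs ys E m Q W (λ x → P x ∧ p x) ⊎ Heavy xs ys E m Q W (λ x → P x ∧ not (p x))
heavy-halve {X} {Y} xs ys E m Q W P p heavy
  with moment xs ys E m P₁ Q * # xs P₁ ≤? # xs P₁ ^ m * W
     | moment xs ys E m P₂ Q * # xs P₂ ≤? # xs P₂ ^ m * W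
  where
  P₁ P₂ : X → Bool
  P₁ x = P x ∧ p x
  P₂ x = P x ∧ not (p x)
... | no h₁  | _      = inj₁ (≰⇒> h₁)
... | yes _  | no h₂  = inj₂ (≰⇒> h₂)
... | yes h₁ | yes h₂ = ⊥-elim (<⇒≱ heavy (begin
  moment xs ys E m P Q * # xs P
    ≡⟨ cong₂ _*_ (∑-cong ys λ y → cong (λ h → ι (Q y) * h ^ m) (degree-split y)) (#-split xs P p) ⟩
  ∑ ys (λ y → ι (Q y) * (# xs (λ x → P₁ x ∧ E x y) + # xs (λ x → P₂ x ∧ E x y)) ^ m) * (# xs P₁ + # xs P₂)
    ≤⟨ combine-moments ys (ι ∘ Q) _ _ m (# xs P₁) (# xs P₂) W (degree-≤ P₁) (degree-≤ P₂) h₁ h₂ ⟩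
  (# xs P₁ + # xs P₂) ^ m * (W + W)
    ≡⟨ cong (λ h → h ^ m * (W + W)) (sym (#-split xs P p)) ⟩
  # xs P ^ m * (W + W) ∎))
  where
  open ≤-Reasoning
  P₁ P₂ : X → Bool
  P₁ x = P x ∧ p x
  P₂ x = P x ∧ not (p x)
  degree-≤ : ∀ R y → # xs (λ x → R x ∧ E x y) ≤ # xs R
  degree-≤ R y = #-mono xs (λ x h → proj₁ (∧-true (R x) _ h))
  swap-∧ : ∀ a b c → (a ∧ b) ∧ c ≡ (a ∧ c) ∧ b
  swap-∧ a b c = trans (∧-assoc a b c) (trans (cong (a ∧_) (∧-comm b c)) (sym (∧-assoc a c b)))
  degree-split : ∀ y → # xs (λ x → P x ∧ E x y) ≡ # xs (λ x → P₁ x ∧ E x y) + # xs (λ x → P₂ x ∧ E x y)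
  degree-split y = trans (#-split xs (λ x → P x ∧ E x y) p)
    (cong₂ _+_ (∑-cong xs λ x → cong ι (swap-∧ (P x) (E x y) (p x)))
               (∑-cong xs λ x → cong ι (swap-∧ (P x) (E x y) (not (p x)))))

-- Each member carries the label of its `χ`-colours to everything after it: later members and the
-- surviving candidates `P′`. `Q′` consists of common neighbours of all members. Only the product of
-- the two sizes is controlled, because the normalised moment of order 0 is `|P| * |Q|`.
record Chain {X Y : Set} (xs : List X) (ys : List Y) (E : X → Y → Bool) {l : ℕ} (χ : X → X → Vec Bool l)
             (m S : ℕ) (P : X → Bool) (Q : Y → Bool) : Set where
  field
    members  : List (X × Vec Bool l)
    length≡  : length members ≡ m
    ordered  : AllPairs (λ v w → χ (proj₁ v) (proj₁ w) ≡ proj₂ v) members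
    inside   : All (λ v → P (proj₁ v) ≡ true) members
    P′       : X → Bool
    Q′       : Y → Bool
    P′⇒P     : ∀ x → P′ x ≡ true → P x ≡ true
    Q′⇒Q     : ∀ y → Q′ y ≡ true → Q y ≡ true
    coloured : All (λ v → ∀ x → P′ x ≡ true → χ (proj₁ v) x ≡ proj₂ v) members
    adjacent : All (λ v → ∀ y → Q′ y ≡ true → E (proj₁ v) y ≡ true) members
    large    : S < # xs P′ * # ys Q′

selected : ∀ b x y z → ι b * x < ι b * y * z → b ≡ true × x < y * z
selected true  x y z lt rewrite +-identityʳ x | +-identityʳ y = refl , lt
selected false x y z ()

-- Averaging over `P`: by `moment-suc` both sides of the heaviness inequality are sums over `v` in
-- `P`, so some summand satisfies it strictly. Outside `P` both summands are 0, which forces `P v`.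
heavy-suc : {X Y : Set} (xs : List X) (ys : List Y) (E : X → Y → Bool) (m : ℕ)
  (P : X → Bool) (Q : Y → Bool) (W : ℕ) → Heavy xs ys E (suc m) Q W P →
  ∃ λ v → P v ≡ true × Heavy xs ys E m (λ y → Q y ∧ E v y) W P
heavy-suc {X} xs ys E m P Q W heavy =
  let v , lt = ∑-<⇒∃< xs (≤-trans (≤-reflexive (cong suc sum-g)) (≤-trans heavy (≤-reflexive (sym sum-f))))
  in v , selected (P v) (a ^ m * W) (M v) a lt
  where
  a : ℕ
  a = # xs P
  M f g : X → ℕ
  M v = moment xs ys E m P (λ y → Q y ∧ E v y)
  f v = ι (P v) * M v * a
  g v = ι (P v) * (a ^ m * W)
  sum-f : ∑ xs f ≡ moment xs ys E (suc m) P Q * a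
  sum-f = trans (∑-*ʳ xs a _) (cong (_* a) (sym (moment-suc xs ys E m P Q)))
  sum-g : ∑ xs g ≡ a ^ suc m * W
  sum-g = trans (∑-*ʳ xs (a ^ m * W) _) (sym (*-assoc a (a ^ m) W))

prepend : {X Y : Set} {xs : List X} {ys : List Y} {E : X → Y → Bool} {l : ℕ} {χ : X → X → Vec Bool l}
  {m S : ℕ} {P P₁ : X → Bool} {Q : Y → Bool} (v : X) (k : Vec Bool l) → P v ≡ true →
  (∀ x → P₁ x ≡ true → P x ≡ true × χ v x ≡ k) →
  Chain xs ys E χ m S P₁ (λ y → Q y ∧ E v y) → Chain xs ys E χ (suc m) S P Q
prepend {Q = Q} v k Pv class rest = record
  { members  = (v , k) ∷ members
  ; length≡  = cong suc length≡
  ; ordered  = All.map (λ h → proj₂ (class _ h)) inside ∷ ordered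
  ; inside   = Pv ∷ All.map (λ h → proj₁ (class _ h)) inside
  ; P′       = P′
  ; Q′       = Q′
  ; P′⇒P     = λ x h → proj₁ (class x (P′⇒P x h))
  ; Q′⇒Q     = λ y h → proj₁ (∧-true (Q y) _ (Q′⇒Q y h))
  ; coloured = (λ x h → proj₂ (class x (P′⇒P x h))) ∷ coloured
  ; adjacent = (λ y h → proj₂ (∧-true (Q y) _ (Q′⇒Q y h))) ∷ adjacent
  ; large    = large }
  where open Chain rest

-- Ramsey's theorem with a common neighbourhood. Passing to the neighbourhood of a suitable v turns
-- the (m+1)-st moment into the m-th without changing its normalised size, and by convexity one of
-- the 2^l colour classes at v keeps a 2^-l fraction of it.
chain : {X Y : Set} (xs : List X) (ys : List Y) (E : X → Y → Bool) {l : ℕ} (χ : X → X → Vec Bool l)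
  (m S : ℕ) (P : X → Bool) (Q : Y → Bool) → Heavy xs ys E m Q ((2 ^ l) ^ m * S) P →
  Chain xs ys E χ m S P Q
chain xs ys E χ zero S P Q heavy = record
  { members = [] ; length≡ = refl ; ordered = [] ; inside = []
  ; P′ = P ; Q′ = Q ; P′⇒P = λ _ h → h ; Q′⇒Q = λ _ h → h
  ; coloured = [] ; adjacent = []
  ; large = subst₂ _<_ (trans (*-identityˡ _) (*-identityˡ S))
      (trans (cong (_* # xs P) (∑-cong ys λ y → *-identityʳ (ι (Q y)))) (*-comm (# ys Q) (# xs P))) heavy }
chain xs ys E {l} χ (suc m) S P Q heavy =
  let v , Pv , heavy₁ = heavy-suc xs ys E m P Q _ heavy
      Q₁ = λ y → Q y ∧ E v y
      k , P₁ , heavy₂ , class = class-pigeonhole (Heavy xs ys E m Q₁) (heavy-halve xs ys E m Q₁) l (χ v) _ P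
        (subst (λ W → Heavy xs ys E m Q₁ W P) (*-assoc (2 ^ l) ((2 ^ l) ^ m) S) heavy₁)
  in prepend v k Pv class (chain xs ys E χ m S P₁ Q₁ heavy₂)

-- Alternating 4-cycles

∑-allFin-suc : ∀ {n} (f : Fin (suc n) → ℕ) → ∑ (allFin (suc n)) f ≡ f zero + ∑ (allFin n) (f ∘ suc)
∑-allFin-suc {n} f = cong (f zero +_)
  (trans (cong (λ xs → ∑ xs f) (sym (map-tabulate id suc))) (∑-map suc (allFin n) f))

∑-point : ∀ {n} (u : Fin n) (f : Fin n → ℕ) → ∑ (allFin n) (λ v → ι (does (u ≟ v)) * f v) ≡ f u
∑-point {suc n} zero    f = trans (∑-allFin-suc (λ v → ι (does (zero ≟ v)) * f v))
  (trans (cong₂ _+_ (+-identityʳ (f zero)) (trans (∑-const (allFin n) 0) (*-zeroʳ (length (allFin n))))) (+-identityʳ (f zero)))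
∑-point {suc n} (suc u) f = trans (∑-allFin-suc (λ v → ι (does (suc u ≟ v)) * f v)) (∑-point u (f ∘ suc))

length-allFin : ∀ n → length (allFin n) ≡ n
length-allFin n = length-tabulate id

pairs : ∀ n → List (Fin n × Fin n)
pairs n = cartesianProduct (allFin n) (allFin n)

∑-pairs : ∀ {n} (f : Fin n × Fin n → ℕ) →
          ∑ (pairs n) f ≡ ∑ (allFin n) (λ u → ∑ (allFin n) (λ v → f (u , v)))
∑-pairs {n} f = ∑-cartesianProduct (allFin n) (allFin n) f

#-all : {X : Set} (xs : List X) → # xs (λ _ → true) ≡ length xs
#-all xs = trans (∑-const xs 1) (*-identityʳ (length xs))

length-pairs : ∀ n → length (pairs n) ≡ n * n
length-pairs n = trans (sym (#-all (pairs n))) (trans (∑-pairs {n} (λ _ → 1))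
  (trans (∑-cong (allFin n) λ _ → trans (#-all (allFin n)) (length-allFin n))
    (trans (∑-const (allFin n) n) (cong (_* n) (length-allFin n)))))

#-pairs-∧ : ∀ {n} (P Q : Fin n → Bool) →
  # (pairs n) (λ w → P (proj₁ w) ∧ Q (proj₂ w)) ≡ # (allFin n) P * # (allFin n) Q
#-pairs-∧ {n} P Q = trans (∑-pairs {n} _)
  (trans (∑-cong (allFin n) λ u → trans (∑-cong (allFin n) λ v → ι-∧ (P u) (Q v)) (∑-*ˡ (allFin n) (ι (P u)) (ι ∘ Q)))
    (∑-*ʳ (allFin n) (# (allFin n) Q) (ι ∘ P)))

adj : ∀ {n} → Colouring n → Bool → Fin n → Fin n → Bool
adj c col u v = not (does (u ≟ v)) ∧ does (Data.Bool._≟_ (c u v) col)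

adj-sym : ∀ {n} (c : Colouring n) → Symmetric c → ∀ col u v → adj c col u v ≡ adj c col v u
adj-sym c symm col u v rewrite symm u v with u ≟ v | v ≟ u
... | yes _    | yes _    = refl
... | no _     | no _     = refl
... | yes refl | no v≢u   = ⊥-elim (v≢u refl)
... | no u≢v   | yes refl = ⊥-elim (u≢v refl)

countTrue-map : {X : Set} (xs : List X) (P : X → Bool) → countTrue (map P xs) ≡ # xs P
countTrue-map []       P = refl
countTrue-map (x ∷ xs) P with P x
... | true  = cong suc (countTrue-map xs P)
... | false = countTrue-map xs P

degIn≡# : ∀ {n} (c : Colouring n) col u → degIn c col u ≡ # (allFin n) (adj c col u)
degIn≡# {n} c col u = countTrue-map (allFin n) (adj c col u)

-- The number of paths from `u` to `v` whose first edge is blue and second edge red; not symmetric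
-- in `u` and `v`.
codeg : ∀ {n} → Colouring n → Fin n → Fin n → ℕ
codeg {n} c u v = # (allFin n) (λ w → adj c blue u w ∧ adj c red v w)

-- Both sides count the union of the two red neighbourhoods, except that `codeg c u v` misses `u`
-- itself when `u v` is red. The correction is the same on both sides because the colouring is
-- symmetric.
codeg-exchange : ∀ {n} (c : Colouring n) → Symmetric c → ∀ u v →
  codeg c u v + degIn c red u ≡ codeg c v u + degIn c red v
codeg-exchange {n} c symm u v = +-cancelʳ-≡ _ _ _ (begin-equality
  codeg c u v + degIn c red u + ι (adj c red v u)       ≡⟨ rotate (codeg c u v) _ _ ⟩
  (codeg c u v + ι (adj c red v u)) + degIn c red u     ≡⟨ cong₂ _+_ (not-red u v) (degIn≡# c red u) ⟩
  # (allFin n) (λ w → not (R u w) ∧ R v w) + # (allFin n) (R u) ≡⟨ sym (∑-+ (allFin n) _ _) ⟩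
  ∑ (allFin n) (λ w → ι (not (R u w) ∧ R v w) + ι (R u w))
    ≡⟨ ∑-cong (allFin n) (λ w → union (R u w) (R v w)) ⟩
  ∑ (allFin n) (λ w → ι (not (R v w) ∧ R u w) + ι (R v w)) ≡⟨ ∑-+ (allFin n) _ _ ⟩
  # (allFin n) (λ w → not (R v w) ∧ R u w) + # (allFin n) (R v)
    ≡⟨ sym (cong₂ _+_ (not-red v u) (degIn≡# c red v)) ⟩
  (codeg c v u + ι (adj c red u v)) + degIn c red v
    ≡⟨ cong (λ h → codeg c v u + ι h + degIn c red v) (adj-sym c symm red u v) ⟩
  (codeg c v u + ι (adj c red v u)) + degIn c red v     ≡⟨ sym (rotate (codeg c v u) _ _) ⟩
  codeg c v u + degIn c red v + ι (adj c red v u)       ∎)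
  where
  open ≤-Reasoning
  R : Fin n → Fin n → Bool
  R = adj c red
  rotate : ∀ a b c → a + b + c ≡ (a + c) + b
  rotate = solve-∀
  union : ∀ a b → ι (not a ∧ b) + ι a ≡ ι (not b ∧ a) + ι b
  union true  true  = refl
  union true  false = refl
  union false true  = refl
  union false false = refl
  cases : ∀ e k r → ι ((not e ∧ does (k Data.Bool.≟ blue)) ∧ r) + ι e * ι r ≡ ι (not (not e ∧ does (k Data.Bool.≟ red)) ∧ r)
  cases true  k     r     = +-identityʳ (ι r)
  cases false true  r     = refl
  cases false false r     = +-identityʳ (ι r)
  not-red : ∀ u v → codeg c u v + ι (R v u) ≡ # (allFin n) (λ w → not (R u w) ∧ R v w)
  not-red u v = trans (cong (codeg c u v +_) (sym (∑-point u (λ w → ι (R v w)))))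
    (trans (sym (∑-+ (allFin n) _ _)) (∑-cong (allFin n) λ w → cases (does (u ≟ w)) (c u w) (R v w)))

codeg-mono : ∀ {n} (c : Colouring n) → Symmetric c → ∀ u v →
  degIn c red v ≤ degIn c red u → codeg c u v ≤ codeg c v u
codeg-mono c symm u v dv≤du = +-cancelʳ-≤ (degIn c red v) _ _
  (≤-trans (+-monoʳ-≤ (codeg c u v) dv≤du) (≤-reflexive (codeg-exchange c symm u v)))

alternating : ∀ {n} → Colouring n → Fin n × Fin n → Fin n × Fin n → Bool
alternating c (u₁ , u₂) (w₁ , w₂) =
  (adj c blue u₁ w₁ ∧ adj c red u₂ w₁) ∧ (adj c blue u₂ w₂ ∧ adj c red u₁ w₂)

#-alternating : ∀ {n} (c : Colouring n) u v →
  # (pairs n) (alternating c (u , v)) ≡ codeg c u v * codeg c v u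
#-alternating c u v = #-pairs-∧ (λ w → adj c blue u w ∧ adj c red v w) (λ w → adj c blue v w ∧ adj c red u w)

threshold : (g : ℕ → ℕ) (B k : ℕ) → B ≤ g 0 → g k < B → ∃ λ τ → B ≤ g τ × g (suc τ) < B
threshold g B zero    h₀ hk = ⊥-elim (<⇒≱ hk h₀)
threshold g B (suc k) h₀ hk with B ≤? g k
... | yes h = k , h , hk
... | no  h = threshold g B k h₀ (≰⇒> h)

≡⇒T : ∀ b → b ≡ true → T b
≡⇒T true _ = tt

-- Let u range over the vertices of largest red degree (about εn/2 of them) and b over the blue
-- neighbours of u. At least half of the red neighbours v of b have red degree at most that of u,
-- and then codeg v u ≥ codeg u v.
alternating-dense : ∀ {n} (c : Colouring n) → Symmetric c → ∀ p q → 0 < p → 2 * p < q → 1 ≤ n →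
  (∀ u → p * n ≤ q * degIn c red u) → (∀ u → p * n ≤ q * degIn c blue u) →
  p ^ 6 * (n * n) ^ 2 ≤
  16 * q ^ 6 * ∑ (pairs n) (λ w → # (pairs n) (λ u → alternating c u w))
alternating-dense {n@(suc _)} c symm p@(suc _) q 0<p 2p<q 1≤n redDeg blueDeg =
  *-cancelˡ-≤ (n * n) (begin
    n * n * (p ^ 6 * (n * n) ^ 2)          ≡⟨ sixth p n ⟩
    (p * n * (p * n * (p * n))) ^ 2        ≤⟨ ^-monoˡ-≤ 2 cubic ⟩
    (4 * (q * q * q) * W) ^ 2              ≡⟨ square q W ⟩
    16 * q ^ 6 * W ^ 2                     ≤⟨ *-monoʳ-≤ (16 * q ^ 6) cauchy ⟩
    16 * q ^ 6 * (n * n * ∑ (pairs n) (λ x → w x ^ 2))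
      ≤⟨ *-monoʳ-≤ (16 * q ^ 6) (*-monoʳ-≤ (n * n) (∑-mono (pairs n) squares)) ⟩
    16 * q ^ 6 * (n * n * ∑ (pairs n) (λ u → # (pairs n) (alternating c u)))
      ≡⟨ cong (λ h → 16 * q ^ 6 * (n * n * h)) (∑-swap (pairs n) (pairs n) _) ⟩
    16 * q ^ 6 * (n * n * Tot)             ≡⟨ commute (16 * q ^ 6) (n * n) Tot ⟩
    n * n * (16 * q ^ 6 * Tot)             ∎)
  where
  open ≤-Reasoning
  V : List (Fin n)
  V = allFin n
  d : Fin n → ℕ
  d = degIn c red
  Tot : ℕ
  Tot = ∑ (pairs n) (λ w → # (pairs n) (λ u → alternating c u w))
  above : ℕ → Fin n → Bool
  above τ u = τ ≤ᵇ d u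
  deg≤n : ∀ u → d u ≤ n
  deg≤n u = ≤-trans (≤-reflexive (degIn≡# c red u))
              (≤-trans (#-≤length V (adj c red u)) (≤-reflexive (length-allFin n)))
  all-above : p * n ≤ 2 * q * # V (above 0)
  all-above = begin
    p * n               ≤⟨ *-monoˡ-≤ n (≤-trans (m≤n*m p 2) (<⇒≤ (<-≤-trans 2p<q (m≤n*m q 2)))) ⟩
    2 * q * n           ≡⟨ cong (2 * q *_) (sym (trans (#-all V) (length-allFin n))) ⟩
    2 * q * # V (above 0) ∎
  none-above : 2 * q * # V (above (suc n)) < p * n
  none-above = ≤-<-trans (≤-reflexive (trans (cong (2 * q *_)
      (trans (∑-cong V empty) (trans (∑-const V 0) (*-zeroʳ (length V))))) (*-zeroʳ (2 * q))))
    (s≤s z≤n)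
    where
    empty : ∀ u → ι (above (suc n) u) ≡ 0
    empty u with above (suc n) u in eq
    ... | false = refl
    ... | true  = ⊥-elim (<⇒≱ (≤ᵇ⇒≤ (suc n) (d u) (≡⇒T _ eq)) (deg≤n u))
  -- With `ε = p / q`: at least `εn/2` vertices have red degree at least `τ`, and fewer than `εn/2`
  -- have a larger one. Hence every `top` vertex has red degree at least that of every `low` one,
  -- and every vertex keeps at least `εn/2` red neighbours in `low`. Degree exactly `τ` is both
  -- `top` and `low`.
  level : ∃ λ τ → p * n ≤ 2 * q * # V (above τ) × 2 * q * # V (above (suc τ)) < p * n
  level = threshold (λ τ → 2 * q * # V (above τ)) (p * n) (suc n) all-above none-above
  τ : ℕ
  τ = proj₁ level
  top low : Fin n → Bool
  top = above τ
  low u = not (above (suc τ) u)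
  w : Fin n × Fin n → ℕ
  w (u , v) = ι (top u) * (ι (low v) * codeg c u v)
  W : ℕ
  W = ∑ (pairs n) w

  lowRed : ∀ b → p * n ≤ 2 * q * # V (λ v → adj c red b v ∧ low v)
  lowRed b = +-cancelˡ-≤ (p * n) _ _ (begin
    p * n + p * n                           ≤⟨ +-mono-≤ (redDeg b) (redDeg b) ⟩
    q * d b + q * d b                       ≡⟨ double q (d b) ⟩
    2 * q * d b
      ≡⟨ cong (2 * q *_) (trans (degIn≡# c red b) (#-split V (adj c red b) (above (suc τ)))) ⟩
    2 * q * (H + L)                         ≡⟨ *-distribˡ-+ (2 * q) H L ⟩
    2 * q * H + 2 * q * L
      ≤⟨ +-monoˡ-≤ (2 * q * L) (≤-trans (*-monoʳ-≤ (2 * q) (#-mono V λ v h → proj₂ (∧-true (adj c red b v) _ h))) (<⇒≤ (proj₂ (proj₂ level)))) ⟩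
    p * n + 2 * q * L                       ∎)
    where
    H L : ℕ
    H = # V (λ v → adj c red b v ∧ above (suc τ) v)
    L = # V (λ v → adj c red b v ∧ low v)
    double : ∀ q d → q * d + q * d ≡ 2 * q * d
    double = solve-∀

  -- Double count of the blue-red paths from `u` to `low` vertices, by end vertex and by middle
  -- vertex.
  lowCodeg : ∀ u → ∑ V (λ v → ι (low v) * codeg c u v) ≡
                   ∑ V (λ b → ι (adj c blue u b) * # V (λ v → adj c red b v ∧ low v))
  lowCodeg u = trans (∑-cong V λ v → sym (∑-*ˡ V (ι (low v)) _))
    (trans (∑-swap V V _) (∑-cong V λ b → trans (∑-cong V λ v → per b v) (∑-*ˡ V (ι (adj c blue u b)) _)))
    where
    rearr : ∀ l x r → l * (x * r) ≡ x * (r * l)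
    rearr = solve-∀
    per : ∀ b v → ι (low v) * ι (adj c blue u b ∧ adj c red v b) ≡ ι (adj c blue u b) * ι (adj c red b v ∧ low v)
    per b v = trans (cong (ι (low v) *_) (ι-∧ (adj c blue u b) (adj c red v b)))
      (trans (rearr (ι (low v)) (ι (adj c blue u b)) (ι (adj c red v b)))
        (cong (ι (adj c blue u b) *_) (trans (cong (λ h → ι h * ι (low v)) (adj-sym c symm red v b))
          (sym (ι-∧ (adj c red b v) (low v))))))

  commute : ∀ a b c → a * (b * c) ≡ b * (a * c)
  commute = solve-∀

  quadratic : ∀ u → p * n * (p * n) ≤ q * (2 * q) * ∑ V (λ v → ι (low v) * codeg c u v)
  quadratic u = begin
    p * n * (p * n)                         ≤⟨ *-monoˡ-≤ (p * n) (blueDeg u) ⟩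
    q * degIn c blue u * (p * n)            ≡⟨ cong (λ h → q * h * (p * n)) (degIn≡# c blue u) ⟩
    q * # V (adj c blue u) * (p * n)
      ≡⟨ trans (*-assoc q _ _) (cong (q *_) (sym (∑-*ʳ V (p * n) (ι ∘ adj c blue u)))) ⟩
    q * ∑ V (λ b → ι (adj c blue u b) * (p * n))
      ≤⟨ *-monoʳ-≤ q (∑-mono V λ b → *-monoʳ-≤ (ι (adj c blue u b)) (lowRed b)) ⟩
    q * ∑ V (λ b → ι (adj c blue u b) * (2 * q * # V (λ v → adj c red b v ∧ low v)))
      ≡⟨ cong (q *_) (trans (∑-cong V λ b → commute (ι (adj c blue u b)) (2 * q) _) (∑-*ˡ V (2 * q) _)) ⟩
    q * (2 * q * ∑ V (λ b → ι (adj c blue u b) * # V (λ v → adj c red b v ∧ low v)))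
      ≡⟨ trans (cong (λ h → q * (2 * q * h)) (sym (lowCodeg u))) (sym (*-assoc q (2 * q) _)) ⟩
    q * (2 * q) * ∑ V (λ v → ι (low v) * codeg c u v) ∎

  cubic : p * n * (p * n * (p * n)) ≤ 4 * (q * q * q) * W
  cubic = begin
    p * n * (p * n * (p * n))               ≤⟨ *-monoˡ-≤ (p * n * (p * n)) (proj₁ (proj₂ level)) ⟩
    2 * q * # V top * (p * n * (p * n))
      ≡⟨ trans (*-assoc (2 * q) _ _) (cong (2 * q *_) (sym (∑-*ʳ V (p * n * (p * n)) (ι ∘ top)))) ⟩
    2 * q * ∑ V (λ u → ι (top u) * (p * n * (p * n)))
      ≤⟨ *-monoʳ-≤ (2 * q) (∑-mono V λ u → *-monoʳ-≤ (ι (top u)) (quadratic u)) ⟩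
    2 * q * ∑ V (λ u → ι (top u) * (q * (2 * q) * ∑ V (λ v → ι (low v) * codeg c u v)))
      ≡⟨ cong (2 * q *_) (trans (∑-cong V λ u → commute (ι (top u)) (q * (2 * q)) _) (∑-*ˡ V (q * (2 * q)) _)) ⟩
    2 * q * (q * (2 * q) * ∑ V (λ u → ι (top u) * ∑ V (λ v → ι (low v) * codeg c u v)))
      ≡⟨ cong (λ h → 2 * q * (q * (2 * q) * h)) (trans (∑-cong V λ u → sym (∑-*ˡ V (ι (top u)) _)) (sym (∑-pairs {n} w))) ⟩
    2 * q * (q * (2 * q) * W)               ≡⟨ collect q W ⟩
    4 * (q * q * q) * W                     ∎
    where
    collect : ∀ q W → 2 * q * (q * (2 * q) * W) ≡ 4 * (q * q * q) * W
    collect = solve-∀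

  -- Cauchy-Schwarz, obtained as the case of exponent 2. It is needed because only the squares of
  -- the path counts compare with the numbers of alternating cycles.
  cauchy : W ^ 2 ≤ n * n * ∑ (pairs n) (λ x → w x ^ 2)
  cauchy = *-cancelʳ-≤ _ _ (n * n) (begin
    W ^ 2 * (n * n)                             ≡⟨ cong (W ^ 2 *_) (sym (length-pairs n)) ⟩
    W ^ 2 * length (pairs n)                    ≤⟨ jensen (pairs n) w 2 ⟩
    length (pairs n) ^ 2 * S                    ≡⟨ cong (λ h → h ^ 2 * S) (length-pairs n) ⟩
    (n * n) ^ 2 * S                             ≡⟨ sq (n * n) S ⟩
    n * n * S * (n * n)                         ∎)
    where
    S : ℕ
    S = ∑ (pairs n) (λ x → w x ^ 2)
    sq : ∀ N S → N * (N * 1) * S ≡ N * S * N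
    sq = solve-∀

  squares : ∀ x → w x ^ 2 ≤ # (pairs n) (alternating c x)
  squares (u , v) with top u in topu | above (suc τ) v in highv
  ... | false | _     = z≤n
  ... | true  | true  = z≤n
  ... | true  | false = begin
    (1 * (1 * codeg c u v)) ^ 2   ≡⟨ one (codeg c u v) ⟩
    codeg c u v * codeg c u v
      ≤⟨ *-monoʳ-≤ (codeg c u v) (codeg-mono c symm u v (≤-trans dv≤τ τ≤du)) ⟩
    codeg c u v * codeg c v u     ≡⟨ sym (#-alternating c u v) ⟩
    # (pairs n) (alternating c (u , v)) ∎
    where
    one : ∀ x → (1 * (1 * x)) * ((1 * (1 * x)) * 1) ≡ x * x
    one = solve-∀
    τ≤du : τ ≤ d u
    τ≤du = ≤ᵇ⇒≤ τ (d u) (≡⇒T _ topu)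
    dv≤τ : d v ≤ τ
    dv≤τ = ≮⇒≥ λ τ<dv → subst T highv (≤⇒≤ᵇ τ<dv)

  sixth : ∀ p n → n * n * (p ^ 6 * (n * n) ^ 2) ≡ (p * n * (p * n * (p * n))) ^ 2
  sixth = expanded
    where
    expanded : ∀ p n → n * n * (p * (p * (p * (p * (p * (p * 1))))) * ((n * n) * ((n * n) * 1))) ≡ (p * n * (p * n * (p * n))) * ((p * n * (p * n * (p * n))) * 1)
    expanded = solve-∀
  square : ∀ q W → (4 * (q * q * q) * W) ^ 2 ≡ 16 * q ^ 6 * W ^ 2
  square = expanded
    where
    expanded : ∀ q W → (4 * (q * q * q) * W) * ((4 * (q * q * q) * W) * 1) ≡ 16 * (q * (q * (q * (q * (q * (q * 1)))))) * (W * (W * 1))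
    expanded = solve-∀

-- Homogeneous sequences of pairs

-- The recursive call strengthens `A` by `R x`, so that the relation of the head to all later picks
-- comes back through the specification.
select : {X : Set} {R : X → X → Set} {A : X → Set} (xs : List X) (P : X → Bool) (s : ℕ) →
  AllPairs R xs → All A xs → s ≤ # xs P →
  Σ (Fin s → X) λ g → (∀ i → P (g i) ≡ true × A (g i)) × (∀ i j → toℕ i < toℕ j → R (g i) (g j))
select xs P zero    _ _ _ = (λ ()) , (λ ()) , λ ()
select {X} {R} {A} (x ∷ xs) P (suc s) (Rx ∷ ordered) (Ax ∷ as) s≤ with P x in Px
... | false = select xs P (suc s) ordered as s≤
... | true with select xs P s ordered (All.zip (as , Rx)) (s≤s⁻¹ s≤)
...   | g , spec , ord = g′ , spec′ , ord′
  where
  g′ : Fin (suc s) → X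
  g′ zero    = x
  g′ (suc i) = g i
  spec′ : ∀ i → P (g′ i) ≡ true × A (g′ i)
  spec′ zero    = Px , Ax
  spec′ (suc i) = proj₁ (spec i) , proj₁ (proj₂ (spec i))
  ord′ : ∀ i j → toℕ i < toℕ j → R (g′ i) (g′ j)
  ord′ zero    (suc j) _         = proj₂ (proj₂ (spec j))
  ord′ (suc i) (suc j) (s≤s i<j) = ord i j i<j

meets : ∀ {n} → Fin n × Fin n → Fin n × Fin n → Bool
meets (u₁ , u₂) (v₁ , v₂) = does (u₁ ≟ v₁) ∨ does (u₂ ≟ v₂)

-- Pairs sharing a coordinate with `u` form one row and one column of the `n × n` grid.
#-meets : ∀ {n} (u : Fin n × Fin n) → # (pairs n) (meets u) ≤ n + n
#-meets {n} (u₁ , u₂) = begin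
  # (pairs n) (meets (u₁ , u₂))               ≡⟨ ∑-pairs {n} _ ⟩
  ∑ V (λ v₁ → # V (λ v₂ → does (u₁ ≟ v₁) ∨ does (u₂ ≟ v₂)))
    ≤⟨ ∑-mono V (λ v₁ → ∑-mono V λ v₂ → union (does (u₁ ≟ v₁)) (does (u₂ ≟ v₂))) ⟩
  ∑ V (λ v₁ → ∑ V (λ v₂ → ι (does (u₁ ≟ v₁)) * 1 + ι (does (u₂ ≟ v₂)) * 1))
    ≡⟨ ∑-cong V (λ v₁ → trans (∑-+ V (λ _ → ι (does (u₁ ≟ v₁)) * 1) _)
         (cong₂ _+_ (trans (∑-const V _) (cong (_* (ι (does (u₁ ≟ v₁)) * 1)) (length-allFin n))) (∑-point u₂ (λ _ → 1)))) ⟩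
  ∑ V (λ v₁ → n * (ι (does (u₁ ≟ v₁)) * 1) + 1)
    ≡⟨ trans (∑-+ V _ _) (cong₂ _+_ (trans (∑-*ˡ V n _) (cong (n *_) (∑-point u₁ (λ _ → 1)))) (∑-const V 1)) ⟩
  n * 1 + length V * 1
    ≡⟨ cong₂ _+_ (*-identityʳ n) (trans (*-identityʳ _) (length-allFin n)) ⟩
  n + n ∎
  where
  open ≤-Reasoning
  V : List (Fin n)
  V = allFin n
  union : ∀ a b → ι (a ∨ b) ≤ ι a * 1 + ι b * 1
  union true  b     = s≤s z≤n
  union false true  = ≤-refl
  union false false = ≤-refl

meets-false : ∀ {n} (u v : Fin n × Fin n) → meets u v ≡ false →
  ¬ proj₁ u ≡ proj₁ v × ¬ proj₂ u ≡ proj₂ v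
meets-false (u₁ , u₂) (v₁ , v₂) h with u₁ ≟ v₁ | u₂ ≟ v₂
meets-false (u₁ , u₂) (v₁ , v₂) h  | no ne₁    | no ne₂ = ne₁ , ne₂
meets-false (u₁ , u₂) (v₁ , v₂) () | no _      | yes _
meets-false (u₁ , u₂) (v₁ , v₂) () | yes _     | _

-- The leading bit also guards against repetition: a chain step does not explicitly remove the
-- chosen pair from the candidates, but a pair meets itself, so a label with leading bit false
-- excludes it.
pairColour : ∀ {n} → Colouring n → Fin n × Fin n → Fin n × Fin n → Vec Bool 4
pairColour c u@(u₁ , u₂) v@(v₁ , v₂) = meets u v ∷ c u₁ v₁ ∷ c u₂ v₂ ∷ c u₁ v₂ ∷ []

record HomogeneousPairs {n : ℕ} (c : Colouring n) (t : ℕ) (A : Fin n × Fin n → Set) : Set where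
  field
    pick    : Fin (t + t) → Fin n × Fin n
    spec    : ∀ i → A (pick i)
    α β γ   : Bool
    ordered : ∀ i j → toℕ i < toℕ j → pairColour c (pick i) (pick j) ≡ false ∷ α ∷ β ∷ γ ∷ []

count-halve : {X : Set} (xs : List X) → ∀ W P (p : X → Bool) → W + W ≤ # xs P →
  W ≤ # xs (λ x → P x ∧ p x) ⊎ W ≤ # xs (λ x → P x ∧ not (p x))
count-halve xs W P p h with W ≤? # xs (λ x → P x ∧ p x) | W ≤? # xs (λ x → P x ∧ not (p x))
... | yes h₁ | _      = inj₁ h₁
... | no _   | yes h₂ = inj₂ h₂
... | no h₁  | no h₂  = ⊥-elim (<⇒≱ (+-mono-< (≰⇒> h₁) (≰⇒> h₂)) (≤-trans h (≤-reflexive (#-split xs P p))))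

-- There are 16 labels, so `16 * (t + t)` members contain `t + t` with the same one. Its leading bit
-- is false: otherwise all surviving candidates, more than `2n` of them, would share a coordinate
-- with one member.
homogeneous : ∀ {n} (c : Colouring n) (t : ℕ) {Y : Set} {ys : List Y} {E S P Q}
  (ch : Chain (pairs n) ys E (pairColour c) (2 ^ 4 * (t + t)) S P Q) →
  n + n < # (pairs n) (Chain.P′ ch) →
  (A : Fin n × Fin n → Set) → All (A ∘ proj₁) (Chain.members ch) → HomogeneousPairs c t A
homogeneous {n} c t ch many A as
  with class-pigeonhole (λ W P → W ≤ # members P) (count-halve members) 4 proj₂ (t + t) (λ _ → true)
         (≤-reflexive (sym (trans (#-all members) length≡)))
  where open Chain ch
... | e ∷ α ∷ β ∷ γ ∷ [] , P₁ , big , P₁⇒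
  with select (Chain.members ch) P₁ (t + t) (Chain.ordered ch) (All.zip (as , All.map apart (Chain.coloured ch))) big
  where
  open Chain ch
  apart : ∀ {v} → (∀ x → P′ x ≡ true → pairColour c (proj₁ v) x ≡ proj₂ v) → head (proj₂ v) ≡ false
  apart {v} h with head (proj₂ v) in eq
  ... | false = refl
  ... | true  = ⊥-elim (<⇒≱ many (≤-trans (#-mono (pairs n) λ x Px → trans (cong head (h x Px)) eq) (#-meets (proj₁ v))))
... | g , spec , ord = record
  { pick    = λ i → proj₁ (g i)
  ; spec    = λ i → proj₁ (proj₂ (spec i))
  ; α = α ; β = β ; γ = γ
  ; ordered = λ i j i<j → trans (ord i j i<j) (colour i) }
  where
  colour : ∀ i → proj₂ (g i) ≡ false ∷ α ∷ β ∷ γ ∷ []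
  colour i with proj₂ (g i) | proj₂ (P₁⇒ (g i) (proj₁ (spec i))) | proj₂ (proj₂ (spec i))
  ... | _ | refl | refl = refl

-- Assembling cliques into the unavoidable patterns

Clique : ∀ {n t} → Colouring n → Bool → (Fin t → Fin n) → Set
Clique c col B = ∀ i j → ¬ i ≡ j → ¬ B i ≡ B j × c (B i) (B j) ≡ col

-- As in `Clique`, distinctness is carried along with the colour: it yields `Injective2`, which
-- colours alone do not give, since diagonal values are arbitrary.
Joined : ∀ {n t} → Colouring n → Bool → (Fin t → Fin n) → (Fin t → Fin n) → Set
Joined c col B B′ = ∀ i j → ¬ B i ≡ B′ j × c (B i) (B′ j) ≡ col

joined-sym : ∀ {n t} (c : Colouring n) → Symmetric c → ∀ {col} {B B′ : Fin t → Fin n} →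
  Joined c col B B′ → Joined c col B′ B
joined-sym c symm J i j = (λ e → proj₁ (J j i) (sym e)) , trans (symm _ _) (proj₂ (J j i))

clique-< : ∀ {n t} (c : Colouring n) → Symmetric c → ∀ {col} {B : Fin t → Fin n} →
  (∀ i j → toℕ i < toℕ j → ¬ B i ≡ B j × c (B i) (B j) ≡ col) → Clique c col B
clique-< c symm h i j i≢j with <-cmp (toℕ i) (toℕ j)
... | tri< i<j _ _ = h i j i<j
... | tri≈ _ i≡j _ = ⊥-elim (i≢j (toℕ-injective i≡j))
... | tri> _ _ j<i = (λ e → proj₁ (h j i j<i) (sym e)) , trans (symm _ _) (proj₂ (h j i j<i))

blocks : ∀ {n k t} (c : Colouring n) (emb : Fin k → Fin t → Fin n) (pat : Fin k → Fin k → Bool) →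
  (∀ a → Clique c (pat a a) (emb a)) → (∀ a b → ¬ a ≡ b → Joined c (pat a b) (emb a) (emb b)) →
  Injective2 emb × FollowsPattern c emb pat
blocks c emb pat cl jo = injective , follows
  where
  injective : Injective2 emb
  injective a b i j e with a ≟ b
  ... | no a≢b = ⊥-elim (proj₁ (jo a b a≢b i j) e)
  ... | yes refl with i ≟ j
  ...   | yes i≡j = refl , i≡j
  ...   | no i≢j  = ⊥-elim (proj₁ (cl a i j i≢j) e)
  follows : FollowsPattern c emb pat
  follows a b i j ne with a ≟ b
  ... | no a≢b   = proj₂ (jo a b a≢b i j)
  ... | yes refl = proj₂ (cl a i j (λ i≡j → ne (refl , i≡j)))

Ktt-from-cliques : ∀ {n t} (c : Colouring n) → Symmetric c → ∀ col {B B′ : Fin t → Fin n} →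
  Clique c (not col) B → Clique c (not col) B′ → Joined c col B B′ → HasKtt t c
Ktt-from-cliques {n} {t} c symm col {B} {B′} cl cl′ jo = col , emb , blocks c emb (patKtt col) cliques joins
  where
  emb : Fin 2 → Fin t → Fin n
  emb zero       = B
  emb (suc zero) = B′
  cliques : ∀ a → Clique c (patKtt col a a) (emb a)
  cliques zero       = cl
  cliques (suc zero) = cl′
  joins : ∀ a b → ¬ a ≡ b → Joined c (patKtt col a b) (emb a) (emb b)
  joins zero       zero       ne = ⊥-elim (ne refl)
  joins zero       (suc zero) _  = jo
  joins (suc zero) zero       _  = joined-sym c symm jo
  joins (suc zero) (suc zero) ne = ⊥-elim (ne refl)

P-from-cliques : ∀ {n t} (c : Colouring n) → Symmetric c → {V₁ V₂ V₃ V₄ : Fin t → Fin n} →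
  Clique c red V₁ → Clique c red V₂ → Clique c blue V₃ → Clique c blue V₄ →
  Joined c red V₁ V₂ → Joined c blue V₃ V₄ →
  Joined c red V₁ V₃ → Joined c red V₂ V₄ → Joined c blue V₁ V₄ → Joined c blue V₂ V₃ → HasP t c
P-from-cliques {n} {t} c symm {V₁} {V₂} {V₃} {V₄} c₁ c₂ c₃ c₄ j₁₂ j₃₄ j₁₃ j₂₄ j₁₄ j₂₃ =
  emb , blocks c emb patP cliques joins
  where
  emb : Fin 4 → Fin t → Fin n
  emb zero                   = V₁
  emb (suc zero)             = V₂
  emb (suc (suc zero))       = V₃
  emb (suc (suc (suc zero))) = V₄
  cliques : ∀ a → Clique c (patP a a) (emb a)
  cliques zero                   = c₁
  cliques (suc zero)             = c₂
  cliques (suc (suc zero))       = c₃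
  cliques (suc (suc (suc zero))) = c₄
  flip : ∀ {col} {B B′ : Fin t → Fin n} → Joined c col B B′ → Joined c col B′ B
  flip = joined-sym c symm
  joins : ∀ a b → ¬ a ≡ b → Joined c (patP a b) (emb a) (emb b)
  joins zero                   zero                   ne = ⊥-elim (ne refl)
  joins zero                   (suc zero)             _  = j₁₂
  joins zero                   (suc (suc zero))       _  = j₁₃
  joins zero                   (suc (suc (suc zero))) _  = j₁₄
  joins (suc zero)             zero                   _  = flip j₁₂
  joins (suc zero)             (suc zero)             ne = ⊥-elim (ne refl)
  joins (suc zero)             (suc (suc zero))       _  = j₂₃
  joins (suc zero)             (suc (suc (suc zero))) _  = j₂₄
  joins (suc (suc zero))       zero                   _  = flip j₁₃
  joins (suc (suc zero))       (suc zero)             _  = flip j₂₃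
  joins (suc (suc zero))       (suc (suc zero))       ne = ⊥-elim (ne refl)
  joins (suc (suc zero))       (suc (suc (suc zero))) _  = j₃₄
  joins (suc (suc (suc zero))) zero                   _  = flip j₁₄
  joins (suc (suc (suc zero))) (suc zero)             _  = flip j₂₄
  joins (suc (suc (suc zero))) (suc (suc zero))       _  = flip j₃₄
  joins (suc (suc (suc zero))) (suc (suc (suc zero))) ne = ⊥-elim (ne refl)

-- The first coordinates are read off the first half of the sequence and the second coordinates off
-- the second half, so that all pairs (first, second) are increasing.
module Halves {n t : ℕ} (c : Colouring n) (symm : Symmetric c) {A : Fin n × Fin n → Set}
              (H : HomogeneousPairs c t A) where
  open HomogeneousPairs H public

  left right : Fin t → Fin n
  left  i = proj₁ (pick (i ↑ˡ t))
  right i = proj₂ (pick (t ↑ʳ i))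

  left-clique : Clique c α left
  left-clique = clique-< c symm λ i j i<j →
    let h = ordered (i ↑ˡ t) (j ↑ˡ t) (subst₂ _<_ (sym (toℕ-↑ˡ i t)) (sym (toℕ-↑ˡ j t)) i<j) in
    proj₁ (meets-false (pick (i ↑ˡ t)) (pick (j ↑ˡ t)) (cong head h)) , cong (head ∘ tail) h

  right-clique : Clique c β right
  right-clique = clique-< c symm λ i j i<j →
    let h = ordered (t ↑ʳ i) (t ↑ʳ j) (subst₂ _<_ (sym (toℕ-↑ʳ t i)) (sym (toℕ-↑ʳ t j)) (+-monoʳ-< t i<j)) in
    proj₂ (meets-false (pick (t ↑ʳ i)) (pick (t ↑ʳ j)) (cong head h)) , cong (head ∘ tail ∘ tail) h

  left-right : ∀ i j → c (left i) (right j) ≡ γ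
  left-right i j = cong (head ∘ tail ∘ tail ∘ tail) (ordered (i ↑ˡ t) (t ↑ʳ j)
    (<-≤-trans (≤-<-trans (≤-reflexive (toℕ-↑ˡ i t)) (toℕ<n i)) (≤-trans (m≤m+n t (toℕ j)) (≤-reflexive (sym (toℕ-↑ʳ t j))))))

adj-true : ∀ {n} (c : Colouring n) col u v → adj c col u v ≡ true → ¬ u ≡ v × c u v ≡ col
adj-true c col u v h with u ≟ v | c u v Data.Bool.≟ col
adj-true c col u v h  | no u≢v | yes e = u≢v , e
adj-true c col u v () | no _   | no _
adj-true c col u v () | yes _  | _

alternating-true : ∀ {n} (c : Colouring n) u w → alternating c u w ≡ true →
  ((¬ proj₁ u ≡ proj₁ w × c (proj₁ u) (proj₁ w) ≡ blue) ×
   (¬ proj₂ u ≡ proj₁ w × c (proj₂ u) (proj₁ w) ≡ red)) ×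
  ((¬ proj₂ u ≡ proj₂ w × c (proj₂ u) (proj₂ w) ≡ blue) ×
   (¬ proj₁ u ≡ proj₂ w × c (proj₁ u) (proj₂ w) ≡ red))
alternating-true c (u₁ , u₂) (w₁ , w₂) h =
  let h₁ , h₂ = ∧-true _ _ h
      a , b   = ∧-true _ _ h₁
      d , e   = ∧-true _ _ h₂
  in (adj-true c _ _ _ a , adj-true c _ _ _ b) , (adj-true c _ _ _ d , adj-true c _ _ _ e)

-- T₁ S₁ T₂ S₂ is a 4-cycle coloured blue, red, blue, red. If no edge of it yields a K_tt, then the
-- colours of the four cliques are forced to alternate as well.
unavoidable-from-cycle : ∀ {n t} (c : Colouring n) → Symmetric c → {T₁ T₂ S₁ S₂ : Fin t → Fin n} →
  ∀ α β γ α′ β′ γ′ →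
  Clique c α T₁ → Clique c β T₂ → Joined c γ T₁ T₂ →
  Clique c α′ S₁ → Clique c β′ S₂ → Joined c γ′ S₁ S₂ →
  Joined c blue T₁ S₁ → Joined c red T₂ S₁ → Joined c blue T₂ S₂ → Joined c red T₁ S₂ →
  LocallyUnavoidable t c
unavoidable-from-cycle {n} {t} c symm {T₁} {T₂} {S₁} {S₂} = go
  where
  ktt : ∀ col {B B′ : Fin t → Fin n} → Clique c (not col) B → Clique c (not col) B′ →
        Joined c col B B′ → LocallyUnavoidable t c
  ktt col cl cl′ jo = inj₁ (Ktt-from-cliques c symm col cl cl′ jo)
  flip : ∀ {col} {B B′ : Fin t → Fin n} → Joined c col B B′ → Joined c col B′ B
  flip = joined-sym c symm
  go : ∀ α β γ α′ β′ γ′ →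
    Clique c α T₁ → Clique c β T₂ → Joined c γ T₁ T₂ →
    Clique c α′ S₁ → Clique c β′ S₂ → Joined c γ′ S₁ S₂ →
    Joined c blue T₁ S₁ → Joined c red T₂ S₁ → Joined c blue T₂ S₂ → Joined c red T₁ S₂ →
    LocallyUnavoidable t c
  go true  _     _     true  _     _     t₁ _  _  s₁ _  _  b₁₁ _ _ _ = ktt blue t₁ s₁ b₁₁
  go true  false _     false _     _     _  t₂ _  s₁ _  _  _ r₂₁ _ _ = ktt red t₂ s₁ r₂₁
  go true  true  _     false true  _     _  t₂ _  _  s₂ _  _ _ b₂₂ _ = ktt blue t₂ s₂ b₂₂
  go true  true  false false false _     t₁ t₂ jt _  _  _  _ _ _ _   = ktt blue t₁ t₂ jt
  go true  true  true  false false true  _  _  _  s₁ s₂ js _ _ _ _   = ktt red s₁ s₂ js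
  -- The cycle `T₁ S₂ T₂ S₁`, coloured red, blue, red, blue, is `V₁ V₃ V₂ V₄`.
  go true  true  true  false false false t₁ t₂ jt s₁ s₂ js b₁₁ r₂₁ b₂₂ r₁₂ =
    inj₂ (P-from-cliques c symm t₁ t₂ s₂ s₁ jt (flip js) r₁₂ r₂₁ b₁₁ b₂₂)
  go false _     _     _     false _     t₁ _  _  _  s₂ _  _ _ _ r₁₂ = ktt red t₁ s₂ r₁₂
  go false true  _     _     true  _     _  t₂ _  _  s₂ _  _ _ b₂₂ _ = ktt blue t₂ s₂ b₂₂
  go false false _     false true  _     _  t₂ _  s₁ _  _  _ r₂₁ _ _ = ktt red t₂ s₁ r₂₁
  go false false true  true  true  _     t₁ t₂ jt _  _  _  _ _ _ _   = ktt red t₁ t₂ jt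
  go false false false true  true  false _  _  _  s₁ s₂ js _ _ _ _   = ktt blue s₁ s₂ js
  -- Exchanging the roles of `T` and `S` keeps the cycle alternating, so the same pattern arises
  -- without interchanging colours.
  go false false false true  true  true  t₁ t₂ jt s₁ s₂ js b₁₁ r₂₁ b₂₂ r₁₂ =
    inj₂ (P-from-cliques c symm s₁ s₂ t₂ t₁ js (flip jt) (flip r₂₁) (flip r₁₂) (flip b₁₁) (flip b₂₂))

-- Numerical estimates and conclusion

size-bound : ∀ p q t n → 0 < p → 2 * p < q → 1 ≤ t → q ^ (577 * t) < n * p ^ (577 * t) →
  2 * ((16 ^ (32 * t)) ^ 3 * (q ^ 6) ^ (32 * t)) < (p ^ 6) ^ (32 * t) * n
size-bound p@(suc _) q t n 0<p 2p<q 1≤t h = *-cancelʳ-< (p ^ j) _ _ (begin-strict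
  2 * ((16 ^ m) ^ 3 * (q ^ 6) ^ m) * p ^ j
    ≡⟨ cong (λ x → 2 * (x * (q ^ 6) ^ m) * p ^ j) (trans (^-*-assoc 16 m 3) (trans (^-*-assoc 2 4 (m * 3)) (cong (2 ^_) (twelve t)))) ⟩
  2 * (2 ^ (384 * t) * (q ^ 6) ^ m) * p ^ j
    ≡⟨ regroup (2 ^ (384 * t)) ((q ^ 6) ^ m) (p ^ j) ⟩
  2 ^ suc (384 * t) * p ^ j * (q ^ 6) ^ m
    ≤⟨ *-monoˡ-≤ ((q ^ 6) ^ m) (*-monoˡ-≤ (p ^ j) (^-monoʳ-≤ 2 (+-monoˡ-≤ (384 * t) 1≤t))) ⟩
  2 ^ j * p ^ j * (q ^ 6) ^ m
    ≡⟨ cong (_* (q ^ 6) ^ m) (sym (^-distribˡ-* 2 p j)) ⟩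
  (2 * p) ^ j * (q ^ 6) ^ m
    ≤⟨ *-monoˡ-≤ ((q ^ 6) ^ m) (^-monoˡ-≤ j (<⇒≤ 2p<q)) ⟩
  q ^ j * (q ^ 6) ^ m
    ≡⟨ exponent q ⟩
  q ^ (577 * t)
    <⟨ h ⟩
  n * p ^ (577 * t)
    ≡⟨ cong (n *_) (sym (exponent p)) ⟩
  n * (p ^ j * (p ^ 6) ^ m)
    ≡⟨ reverse n (p ^ j) ((p ^ 6) ^ m) ⟩
  (p ^ 6) ^ m * n * p ^ j ∎)
  where
  open ≤-Reasoning
  j m : ℕ
  -- The constants amount to `2 * 2 ^ (384 * t)`, at most `2 ^ j`, and each 2 is paid for by a
  -- factor `q / p`. The density exponent 6 over `32 * t` steps adds `192 * t`, which gives
  -- `577 * t`.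
  j = 385 * t
  m = 32 * t
  twelve : ∀ t → 4 * (32 * t * 3) ≡ 384 * t
  twelve = solve-∀
  regroup : ∀ a b c → 2 * (a * b) * c ≡ 2 * a * c * b
  regroup = solve-∀
  reverse : ∀ a b c → a * (b * c) ≡ c * a * b
  reverse = solve-∀
  exponent : ∀ x → x ^ j * (x ^ 6) ^ m ≡ x ^ (577 * t)
  exponent x = trans (cong (x ^ j *_) (^-*-assoc x 6 m)) (trans (sym (^-distribˡ-+-* x j (6 * m))) (cong (x ^_) (total t)))
    where
    total : ∀ t → 385 * t + 6 * (32 * t) ≡ 577 * t
    total = solve-∀

-- By convexity the normalised moment is at least `N² (p⁶ / (16 q⁶))ᵐ` with `N = n²`. Of the three
-- factors `16 ^ m` in the size condition, one is this density constant, one pays for the label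
-- choices of the first chain, and one is reserved for the second chain.
moment-large : ∀ {n} (c : Colouring n) p q m → 0 < p → 1 ≤ n →
  p ^ 6 * (n * n) ^ 2 ≤ 16 * q ^ 6 * ∑ (pairs n) (λ w → # (pairs n) (λ u → alternating c u w)) →
  2 * ((16 ^ m) ^ 3 * (q ^ 6) ^ m) < (p ^ 6) ^ m * n →
  Heavy (pairs n) (pairs n) (alternating c) m (λ _ → true) (16 ^ m * (n * n * (16 ^ m * (n + n)))) (λ _ → true)
moment-large {n@(suc _)} c p q m 0<p 1≤n dense size =
  subst₂ _<_ (cong (λ h → h ^ m * (a * (N * (a * (n + n))))) (sym all≡N)) (cong₂ _*_ F≡ (sym all≡N))
    (*-cancelˡ-< (a * Q) _ _ (*-cancelʳ-< (N ^ m) _ _ (begin-strict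
      a * Q * (N ^ m * (a * (N * (a * (n + n))))) * N ^ m   ≡⟨ collect a Q (N ^ m) N n ⟩
      2 * (a ^ 3 * Q) * (N ^ m * N ^ m * N * n)
        <⟨ *-monoˡ-< (N ^ m * N ^ m * N * n) ⦃ positive ⦄ size ⟩
      P * n * (N ^ m * N ^ m * N * n)
        ≡⟨ trans (square P (N ^ m) n) (cong (λ h → P * h * (N * N)) (sym N²ᵐ)) ⟩
      P * (N ^ 2) ^ m * (N * N)
        ≡⟨ cong (_* (N * N)) (sym (^-distribˡ-* (p ^ 6) (N ^ 2) m)) ⟩
      (p ^ 6 * N ^ 2) ^ m * (N * N)                         ≤⟨ *-monoˡ-≤ (N * N) (^-monoˡ-≤ m dense) ⟩
      (16 * q ^ 6 * Tot) ^ m * (N * N)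
        ≡⟨ cong (_* (N * N)) (trans (^-distribˡ-* (16 * q ^ 6) Tot m) (cong (_* Tot ^ m) (^-distribˡ-* 16 (q ^ 6) m))) ⟩
      a * Q * Tot ^ m * (N * N)                             ≡⟨ assoc (a * Q) (Tot ^ m) N ⟩
      a * Q * (Tot ^ m * N) * N
        ≤⟨ *-monoˡ-≤ N (*-monoʳ-≤ (a * Q) (subst (λ L → Tot ^ m * L ≤ L ^ m * F) (length-pairs n) (jensen (pairs n) degree m))) ⟩
      a * Q * (N ^ m * F) * N                               ≡⟨ rotate (a * Q) (N ^ m) F N ⟩
      a * Q * (F * N) * N ^ m                               ∎)))
  where
  open ≤-Reasoning
  N a Q P F Tot : ℕ
  degree : Fin n × Fin n → ℕ
  degree w = # (pairs n) (λ u → alternating c u w)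
  N = n * n
  a = 16 ^ m
  Q = (q ^ 6) ^ m
  P = (p ^ 6) ^ m
  F = ∑ (pairs n) (λ w → degree w ^ m)
  Tot = ∑ (pairs n) degree
  all≡N : # (pairs n) (λ _ → true) ≡ N
  all≡N = trans (#-all (pairs n)) (length-pairs n)
  F≡ : F ≡ moment (pairs n) (pairs n) (alternating c) m (λ _ → true) (λ _ → true)
  F≡ = ∑-cong (pairs n) λ w → sym (*-identityˡ (degree w ^ m))
  positive : NonZero (N ^ m * N ^ m * N * n)
  positive = m*n≢0 _ n ⦃ m*n≢0 _ N ⦃ m*n≢0 (N ^ m) (N ^ m) ⦃ m^n≢0 N m ⦄ ⦃ m^n≢0 N m ⦄ ⦄ ⦄
  N²ᵐ : (N ^ 2) ^ m ≡ N ^ m * N ^ m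
  N²ᵐ = trans (cong (λ h → (N * h) ^ m) (*-identityʳ N)) (^-distribˡ-* N N m)
  collect : ∀ a Q x N n → a * Q * (x * (a * (N * (a * (n + n))))) * x ≡ 2 * (a * (a * (a * 1)) * Q) * (x * x * N * n)
  collect = solve-∀
  square : ∀ P x n → P * n * (x * x * (n * n) * n) ≡ P * (x * x) * (n * n * (n * n))
  square = solve-∀
  assoc : ∀ x y N → x * y * (N * N) ≡ x * (y * N) * N
  assoc = solve-∀
  rotate : ∀ x y F N → x * (y * F) * N ≡ x * (F * N) * y
  rotate = solve-∀

factors-large : ∀ {x y N R} → N * R < x * y → x ≤ N → y ≤ N → R < x × R < y
factors-large {x} {y} {N} {R} lt x≤N y≤N =
  ≰⇒> (λ x≤R → <⇒≱ lt (≤-trans (*-mono-≤ x≤R y≤N) (≤-reflexive (*-comm R N)))) ,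
  ≰⇒> (λ y≤R → <⇒≱ lt (*-mono-≤ x≤N y≤R))

-- Ordinary Ramsey as a special case of `chain`: with a single dummy vertex joined to everything on
-- the other side, the normalised moment of `P` is `|P|`.
ramsey-heavy : {X : Set} (xs : List X) (P : X → Bool) (m R : ℕ) → R < # xs P →
  Heavy xs (tt ∷ []) (λ _ _ → true) m (λ _ → true) R P
ramsey-heavy xs P m R lt = subst (# xs P ^ m * R <_) (cong (_* # xs P) moment≡)
  (*-monoʳ-< (# xs P ^ m) ⦃ m^n≢0 (# xs P) m ⦃ >-nonZero (≤-<-trans z≤n lt) ⦄ ⦄ lt)
  where
  moment≡ : # xs P ^ m ≡ 1 * # xs (λ x → P x ∧ true) ^ m + 0
  moment≡ = trans (cong (_^ m) (∑-cong xs λ x → cong ι (sym (∧-identityʳ (P x)))))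
    (sym (trans (+-identityʳ _) (*-identityˡ _)))

unavoidable-from-pairs : ∀ {n t} (c : Colouring n) → Symmetric c → {A B : Fin n × Fin n → Set} →
  (∀ u w → A u → B w → alternating c u w ≡ true) →
  HomogeneousPairs c t A → HomogeneousPairs c t B → LocallyUnavoidable t c
unavoidable-from-pairs {n} {t} c symm AB homT homS =
  unavoidable-from-cycle c symm T.α T.β T.γ S.α S.β S.γ
    T.left-clique T.right-clique (λ i j → T-apart i j , T.left-right i j)
    S.left-clique S.right-clique (λ i j → S-apart i j , S.left-right i j)
    T₁S₁ T₂S₁ T₂S₂ T₁S₂
  where
  module T = Halves c symm homT
  module S = Halves c symm homS
  edges : ∀ i j → _
  edges i j = alternating-true c (T.pick i) (S.pick j) (AB _ _ (T.spec i) (S.spec j))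
  T₁S₁ : Joined c blue T.left S.left
  T₁S₁ i j = proj₁ (proj₁ (edges (i ↑ˡ t) (j ↑ˡ t)))
  T₂S₁ : Joined c red T.right S.left
  T₂S₁ i j = proj₂ (proj₁ (edges (t ↑ʳ i) (j ↑ˡ t)))
  T₂S₂ : Joined c blue T.right S.right
  T₂S₂ i j = proj₁ (proj₂ (edges (t ↑ʳ i) (t ↑ʳ j)))
  T₁S₂ : Joined c red T.left S.right
  T₁S₂ i j = proj₂ (proj₂ (edges (i ↑ˡ t) (t ↑ʳ j)))
  -- A common vertex would send both a blue and a red edge to the same vertex of `S.left`.
  T-apart : ∀ i j → ¬ T.left i ≡ T.right j
  T-apart i j e = case trans (sym (proj₂ (T₁S₁ i i))) (trans (cong (λ x → c x (S.left i)) e) (proj₂ (T₂S₁ j i))) of λ ()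
  S-apart : ∀ i j → ¬ S.left i ≡ S.right j
  S-apart i j e = case trans (sym (proj₂ (T₁S₁ i i))) (trans (cong (c (T.left i)) e) (proj₂ (T₁S₂ i j))) of λ ()

theorem2 : Σ ℕ λ C → (1 ≤ C) ×
    ((p q t n : ℕ) → 0 < p → 2 * p < q → 1 ≤ t → 1 ≤ n →
    q ^ (C * t) < n * p ^ (C * t) →
    (c : Colouring n) → Symmetric c →
    ((u : _) → p * n ≤ q * degIn c red u) →
    ((u : _) → p * n ≤ q * degIn c blue u) →
    LocallyUnavoidable t c)
theorem2 = 577 , s≤s z≤n , proof
  where
  proof : (p q t n : ℕ) → 0 < p → 2 * p < q → 1 ≤ t → 1 ≤ n →
    q ^ (577 * t) < n * p ^ (577 * t) →
    (c : Colouring n) → Symmetric c →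
    ((u : _) → p * n ≤ q * degIn c red u) →
    ((u : _) → p * n ≤ q * degIn c blue u) →
    LocallyUnavoidable t c
  proof p q t n 0<p 2p<q 1≤t 1≤n size c symm redDeg blueDeg =
    unavoidable-from-pairs c symm (λ u w Au Bw → Au w Bw) homT homS
    where
    m R : ℕ
    m = 2 ^ 4 * (t + t)
    -- Enough for the second chain to lose `16 ^ m` in label choices and still keep more than
    -- `n + n` candidates.
    R = 16 ^ m * (n + n)
    V² : List (Fin n × Fin n)
    V² = pairs n
    m≡ : 32 * t ≡ m
    m≡ = eq t
      where
      eq : ∀ t → 32 * t ≡ 16 * (t + t)
      eq = solve-∀
    size≤ : (P : Fin n × Fin n → Bool) → # V² P ≤ n * n
    size≤ P = ≤-trans (#-≤length V² P) (≤-reflexive (length-pairs n))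

    chainT : Chain V² V² (alternating c) (pairColour c) m (n * n * R) (λ _ → true) (λ _ → true)
    chainT = chain V² V² (alternating c) (pairColour c) m (n * n * R) (λ _ → true) (λ _ → true)
      (moment-large c p q m 0<p 1≤n (alternating-dense c symm p q 0<p 2p<q 1≤n redDeg blueDeg)
        (subst (λ m → 2 * ((16 ^ m) ^ 3 * (q ^ 6) ^ m) < (p ^ 6) ^ m * n) m≡ (size-bound p q t n 0<p 2p<q 1≤t size)))
    module CT = Chain chainT
    bothLarge : R < # V² CT.P′ × R < # V² CT.Q′
    -- Neither set exceeds `n * n`, so a product above `n * n * R` makes both exceed `R`.
    bothLarge = factors-large CT.large (size≤ CT.P′) (size≤ CT.Q′)
    homT : HomogeneousPairs c t (λ u → ∀ w → CT.Q′ w ≡ true → alternating c u w ≡ true)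
    homT = homogeneous c t chainT (≤-<-trans (m≤n*m (n + n) (16 ^ m) ⦃ m^n≢0 16 m ⦄) (proj₁ bothLarge)) _ CT.adjacent

    -- Running inside `CT.Q′` makes every member alternating with every member of the first chain.
    chainS : Chain V² (tt ∷ []) (λ _ _ → true) (pairColour c) m (n + n) CT.Q′ (λ _ → true)
    chainS = chain V² (tt ∷ []) (λ _ _ → true) (pairColour c) m (n + n) CT.Q′ (λ _ → true)
      (ramsey-heavy V² CT.Q′ m R (proj₂ bothLarge))
    module CS = Chain chainS
    homS : HomogeneousPairs c t (λ w → CT.Q′ w ≡ true)
    homS = homogeneous c t chainS
      (<-≤-trans CS.large (≤-trans (*-monoʳ-≤ (# V² CS.P′) (#-≤length (tt ∷ []) CS.Q′)) (≤-reflexive (*-identityʳ _))))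
      _ CS.inside
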